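{- Let $\boldsymbol d$ be a Wadge degree with $\boldsymbol d\subseteq\boldsymbol{\Pi}^0_3$ and $\boldsymbol d\neq\{\emptyset\},\{2^\omega\}$. Then $\mathscr W_{\boldsymbol d}=\{[A]\in\mathrm{MALG}:\Phi(A)\in\boldsymbol d\}$ is topologically dense in $\mathrm{MALG}$: for every measurable $A$ and every $\varepsilon>0$ there is a measurable $B$ with $\mu(A\triangle B)<\varepsilon$ and $\Phi(B)\in\boldsymbol d$. Moreover $B$ can be chosen so that $\Phi(B)=\Phi(U)=\Phi(C)$ for some open $U$ and some closed $C$.
   Context: $2^\omega$ is the Cantor space; $N_s=\{x:s\subset x\}$; $\mu$ the coin-tossing measure, $\mu(N_s)=2^{ -\mathrm{lh}(s)}$. $\Phi(A)=\{x:\lim_n\mu(A\cap N_{x\restriction n})/\mu(N_{x\restriction n})=1\}$ for measurable $A$. $\mathrm{MALG}$ is the measure algebra (measurable sets modulo null sets) with metric $\delta([A],[B])=\mu(A\triangle B)$. For $X,Y\subseteq2^\omega$, $X\le_W Y$ iff $X=f^{ -1}(Y)$ for some continuous $f:2^\omega\to2^\omega$; $X\equiv_W Y$ iff both $X\le_W Y$ and $Y\le_W X$; a Wadge degree is an $\equiv_W$-equivalence class. $\boldsymbol{\Pi}^0_3$ is the class of $F_{\sigma\delta}$ sets. -}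

module Defs where

open import Level using (0ℓ; suc; _⊔_)
open import Data.Bool using (Bool)
open import Data.List using (List; []; _∷_; length; applyUpTo; foldr)
open import Data.Nat using (ℕ) renaming (_≤_ to _≤ℕ_)
open import Data.Product using (∃; ∃-syntax; _×_; proj₁)
open import Data.Rational using (ℚ; 0ℚ; 1ℚ; ½; _+_; _-_; _*_; _≤_; _<_)
open import Relation.Binary.PropositionalEquality using (_≡_)
open import Relation.Nullary using (¬_)
open import Relation.Unary using (Pred; _∈_; _⊆_; _≐_; _∩_; _∪_; _∖_; ∁; ⋃; ⋂; _⊢_)

------------------------------------------------------------------------
-- Cantor space

Cantor : Set
Cantor = ℕ → Bool

-- Equality of subsets is _≐_.
Subset : Set₁
Subset = Pred Cantor 0ℓ

_↾_ : Cantor → ℕ → List Bool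
x ↾ n = applyUpTo x n

N : List Bool → Subset
N s x = x ↾ length s ≡ s

IsOpen : Subset → Set
IsOpen V = ∀ x → x ∈ V → ∃[ n ] N (x ↾ n) ⊆ V

IsClosed : Subset → Set
IsClosed C = IsOpen (∁ C)

IsΠ⁰₃ : Subset → Set₁
IsΠ⁰₃ X = ∃ λ (F : ℕ → ℕ → Subset) →
  (∀ m n → IsClosed (F m n)) × X ≐ ⋂ ℕ (λ m → ⋃ ℕ (λ n → F m n))

-- x ↾ n ≡ y ↾ n says that x and y agree below n.
Continuous : (Cantor → Cantor) → Set
Continuous f = ∀ x n → ∃[ m ] (∀ y → x ↾ m ≡ y ↾ m → f x ↾ n ≡ f y ↾ n)

------------------------------------------------------------------------
-- Wadge reducibility

infix 4 _≤W_ _≡W_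

_≤W_ : Subset → Subset → Set
X ≤W Y = ∃ λ (f : Cantor → Cantor) → Continuous f × X ≐ (f ⊢ Y)

_≡W_ : Subset → Subset → Set
X ≡W Y = (X ≤W Y) × (Y ≤W X)

IsWadgeDegree : Pred Subset 0ℓ → Set₁
IsWadgeDegree d = ∃ λ X → d ≐ (X ≡W_)

------------------------------------------------------------------------
-- The coin-tossing measure

weight : List Bool → ℚ
weight []      = 1ℚ
weight (_ ∷ s) = ½ * weight s

-- The sum of the weights of c 0, …, c (n - 1).
partialSum : (ℕ → List Bool) → ℕ → ℚ
partialSum c n = foldr _+_ 0ℚ (applyUpTo (λ i → weight (c i)) n)

_CoveredBy_ : Subset → (ℕ → List Bool) → Set
A CoveredBy c = A ⊆ ⋃ ℕ (λ i → N (c i))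

-- The measure of A is the real number
--   μ(A) = inf { Σᵢ 2^(- lh sᵢ) : A ⊆ ⋃ᵢ N_{sᵢ} },
-- that is, the outer measure generated by μ(N_s) = 2^(- lh s), which on
-- measurable sets is the coin-tossing measure.  It is given by its two
-- Dedekind cuts: μ[ A ]< q says μ(A) < q, and q <μ[ A ] says q < μ(A).
μ[_]<_ : Subset → ℚ → Set
μ[ A ]< q = ∃ λ c → A CoveredBy c ×
  (∃[ r ] (r < q × (∀ n → partialSum c n ≤ r)))

_<μ[_] : ℚ → Subset → Set
q <μ[ A ] = ∃[ r ] (q < r × ¬ (μ[ A ]< r))

-- Carathéodory's criterion, μ(E ∩ A) + μ(E ∖ A) ≤ μ(E) for every E, in
-- terms of upper cuts; the reverse inequality is subadditivity.
Measurable : Subset → Set₁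
Measurable A = ∀ (E : Subset) q → μ[ E ]< q →
  ∃[ r ] ∃[ s ] (r + s ≡ q × μ[ E ∩ A ]< r × μ[ E ∖ A ]< s)

_△_ : Subset → Subset → Subset
A △ B = (A ∖ B) ∪ (B ∖ A)

-- x ∈ Φ A iff μ(A ∩ N_{x↾n}) / μ(N_{x↾n}) → 1, with denominators cleared
-- in |μ(A ∩ N_{x↾n}) / μ(N_{x↾n}) - 1| < ε.
Φ : Subset → Subset
Φ A x = ∀ ε → 0ℚ < ε → ∃[ n₀ ] (∀ n → n₀ ≤ℕ n →
  ((1ℚ - ε) * weight (x ↾ n)) <μ[ A ∩ N (x ↾ n) ] ×
  (μ[ A ∩ N (x ↾ n) ]< ((1ℚ + ε) * weight (x ↾ n))))

------------------------------------------------------------------------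
-- The measure algebra

-- Points are given by representatives; _≈_ is equality of classes.
MALG : Set₁
MALG = ∃ Measurable

δ[_,_]<_ : MALG → MALG → ℚ → Set
δ[ a , b ]< ε = μ[ proj₁ a △ proj₁ b ]< ε

infix 4 _≈_

_≈_ : MALG → MALG → Set
a ≈ b = ∀ ε → 0ℚ < ε → δ[ a , b ]< ε

Dense : ∀ {ℓ} → Pred MALG ℓ → Set (suc 0ℓ ⊔ ℓ)
Dense P = ∀ a ε → 0ℚ < ε → ∃[ b ] (b ∈ P × δ[ a , b ]< ε)

-- The set of all classes [A] with Φ(A) ∈ d.
𝒲 : Pred Subset 0ℓ → Pred MALG (suc 0ℓ)
𝒲 d b = ∃ λ (a : MALG) → a ≈ b × Φ (proj₁ a) ∈ d

{-# OPTIONS --safe #-}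

-- Let d be the degree of X ∈ Π⁰₃ and let φ be a rank with x ∈ X iff φ(x ↾ k) → ∞.
-- Call u mixed if N_u meets both X and its complement.  Approximate A by a clopen
-- set and, inside a small cylinder, replace it by an open set B which is locally
-- clopen off a copy K of the set of all x with every x ↾ k mixed.  The branch of
-- K coding x spends long stretches with everything off K put into B, except that
-- at the node coding x ↾ k a piece of relative measure 2^(-1 - φ(x ↾ k)) is
-- removed.  Hence this branch is in Φ(B) iff φ(x ↾ k) → ∞, that is, iff x ∈ X.
-- Where K is left below a mixed u, B is clopen and is sent to points of X ∩ N_u
-- and N_u ∖ X; so Φ(B) ≡W X.  The same densities are obtained for every set
-- between B and B ∪ K, which is closed.

module Submission where

open import Level using (0ℓ)
open import Axiom.ExcludedMiddle using (ExcludedMiddle)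
open import Data.Bool using (Bool; true; false; if_then_else_)
import Data.Bool.Properties as Bool
open import Data.Empty using (⊥; ⊥-elim)
open import Data.Integer.Base as ℤ using ()
open import Data.List using (List; []; _∷_; length; applyUpTo; foldr; _++_; replicate)
open import Data.List.Properties using (∷-injective; length-replicate; length-applyUpTo)
open import Data.Maybe using (Maybe; just; nothing; map)
open import Data.Nat.Base as ℕ using (ℕ; zero; suc)
open import Data.Nat.Coprimality using (1-coprimeTo)
import Data.Nat.Properties as ℕ
open import Data.Product using (∃; ∃-syntax; _×_; _,_; proj₁; proj₂)
open import Data.Rational using (ℚ; mkℚ; 0ℚ; 1ℚ; ½; _+_; _-_; _*_; -_; _≤_; _<_; *≤*; 1/_; Positive; positive; nonNegative)
open import Data.Rational.Properties
open import Data.Rational.Solver using (module +-*-Solver)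
import Data.Rational.Unnormalised.Base as ℚᵘ
import Data.Rational.Unnormalised.Properties as ℚᵘ
open import Data.Sum using (_⊎_; inj₁; inj₂; [_,_]′)
open import Data.Unit using (tt)
open import Relation.Binary.PropositionalEquality using (_≡_; refl; sym; trans; cong; cong₂; subst; subst₂; module ≡-Reasoning)
open import Relation.Nullary using (¬_; Dec; yes; no; contradiction)
open import Relation.Unary using (Pred; _∈_; _⊆_; _≐_; _∩_; _∖_; ∁; ∅; U)
open import Defs
open +-*-Solver using (solve; con; _:=_; _:+_; _:*_; _:-_)

-- The reduction of Φ(B) to X must be continuous at the points of K, so whatever lies off K near the
-- branch coding x, in B or not, has to be sent close to x. Below u this takes points of N_u in X
-- and points of N_u outside X, which exist precisely when u is mixed. Once u is no longer mixed, X
-- is constant on N_u and the coding can stop there. As d is neither {∅} nor {2^ω}, the empty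
-- sequence is mixed and the construction can begin. Density is a limit over all prefixes of a
-- branch, also those between two coding nodes. After the fork at u a delay of lh(u) bits makes
-- either child lose at most 2^(-lh(u)); this is at most 2^(-φ(u)) because the rank is truncated at
-- the length. Lower bounds on densities come from covering the complement of B, with K included;
-- upper bounds come from a cylinder disjoint from B ∪ K. So neither depends on the part of K that
-- is added. Each root hands half of its cylinder to a subtree where every point is decided, which
-- makes K null and B measurable.

-- Rational inequalities and sums

-- Farkas certificates: an inequality follows from a combination s ≤ t of the
-- hypotheses and the ring identity a + t ≡ b + s.
≤-from : ∀ {a b s t} → s ≤ t → a + t ≡ b + s → a ≤ b
≤-from {a} {b} {s} {t} s≤t eq = subst₂ _≤_
  (solve 2 (λ a s → a :+ s :- s := a) refl a s)
  (trans (cong (_- s) eq) (solve 2 (λ b s → b :+ s :- s := b) refl b s))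
  (+-monoˡ-≤ (- s) (+-monoʳ-≤ a s≤t))

<-from : ∀ {a b s t} → s < t → a + t ≡ b + s → a < b
<-from {a} {b} {s} {t} s<t eq = subst₂ _<_
  (solve 2 (λ a s → a :+ s :- s := a) refl a s)
  (trans (cong (_- s) eq) (solve 2 (λ b s → b :+ s :- s := b) refl b s))
  (+-monoˡ-< (- s) (+-monoʳ-< a s<t))

p≤p+q : ∀ {p q} → 0ℚ ≤ q → p ≤ p + q
p≤p+q {p} {q} 0≤q = subst (_≤ p + q) (+-identityʳ p) (+-monoʳ-≤ p 0≤q)

*-monoʳ-≤ : ∀ {a b} c → 0ℚ ≤ c → a ≤ b → c * a ≤ c * b
*-monoʳ-≤ c 0≤c = *-monoˡ-≤-nonNeg c {{nonNegative 0≤c}}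

*-monoʳ-< : ∀ {a b} c → 0ℚ < c → a < b → c * a < c * b
*-monoʳ-< c 0<c = *-monoʳ-<-pos c {{positive 0<c}}

*-positive : ∀ {a b} → 0ℚ < a → 0ℚ < b → 0ℚ < a * b
*-positive {a} {b} 0<a 0<b = subst (_< a * b) (*-zeroʳ a) (*-monoʳ-< a 0<a 0<b)

0<1 : 0ℚ < 1ℚ
0<1 = positive⁻¹ 1ℚ

0<½ : 0ℚ < ½
0<½ = positive⁻¹ ½

0≤½ : 0ℚ ≤ ½
0≤½ = <⇒≤ 0<½

½-positive : ∀ {q} → 0ℚ < q → 0ℚ < ½ * q
½-positive = *-positive 0<½

2⁻_ : ℕ → ℚ
2⁻ zero  = 1ℚ
2⁻ suc n = ½ * 2⁻ n

2⁻-positive : ∀ n → 0ℚ < 2⁻ n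
2⁻-positive zero    = 0<1
2⁻-positive (suc n) = ½-positive (2⁻-positive n)

2⁻-suc : ∀ n → 2⁻ suc n ≤ 2⁻ n
2⁻-suc n = ≤-from (<⇒≤ (2⁻-positive (suc n)))
  (solve 1 (λ a → con ½ :* a :+ con ½ :* a := a :+ con 0ℚ) refl (2⁻ n))

2⁻-antitone : ∀ {m n} → m ℕ.≤ n → 2⁻ n ≤ 2⁻ m
2⁻-antitone m≤n = go (ℕ.≤⇒≤′ m≤n)
  where
  go : ∀ {m n} → m ℕ.≤′ n → 2⁻ n ≤ 2⁻ m
  go (ℕ.≤′-reflexive refl) = ≤-refl
  go {m} {suc n} (ℕ.≤′-step m≤n) = ≤-trans {j = 2⁻ n} (2⁻-suc n) (go m≤n)

2⁻≤1 : ∀ n → 2⁻ n ≤ 1ℚ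
2⁻≤1 n = 2⁻-antitone {0} {n} ℕ.z≤n

1/suc : ℕ → ℚ
1/suc n = mkℚ (ℤ.+ 1) n (1-coprimeTo (suc n))

-- The comparison makes powers of ½ small: a positive rational with denominator d + 1 is at least
-- `1/suc d`.
2⁻≤1/suc : ∀ n → 2⁻ n ≤ 1/suc n
2⁻≤1/suc zero    = ≤-refl
2⁻≤1/suc (suc n) = ≤-trans (*-monoʳ-≤ ½ 0≤½ (2⁻≤1/suc n)) (toℚᵘ-cancel-≤
  (ℚᵘ.≤-respˡ-≃ (ℚᵘ.≃-sym (toℚᵘ-homo-* ½ (1/suc n)))
    (ℚᵘ.*≤* (ℤ.+≤+ (ℕ.+-mono-≤ {suc (suc n)} {2 ℕ.* suc n} {0} {0}
      (ℕ.≤-trans (ℕ.+-monoʳ-≤ 1 (ℕ.m≤n+m (suc n) n)) (ℕ.≤-reflexive (cong (λ k → suc (n ℕ.+ k)) (sym (ℕ.+-identityʳ (suc n)))))) ℕ.z≤n)))))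

2⁻-small : ∀ {ε} → 0ℚ < ε → ∃[ n ] 2⁻ n < ε
2⁻-small {ε} 0<ε = go ε {{positive 0<ε}}
  where
  go : ∀ ε → .{{Positive ε}} → ∃[ n ] 2⁻ n < ε
  go (mkℚ ℤ.+[1+ k ] d c) = suc d , <-≤-trans
    (<-from (2⁻-positive (suc d)) (solve 1 (λ a → con ½ :* a :+ con ½ :* a := a :+ con 0ℚ) refl (2⁻ d)))
    (≤-trans (2⁻≤1/suc d) (*≤* (ℤ.+≤+ (ℕ.*-monoˡ-≤ (suc d) (ℕ.s≤s (ℕ.z≤n {k}))))))

weight-2⁻ : ∀ s → weight s ≡ 2⁻ length s
weight-2⁻ []      = refl
weight-2⁻ (_ ∷ s) = cong (½ *_) (weight-2⁻ s)

weight-positive : ∀ s → 0ℚ < weight s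
weight-positive s = subst (0ℚ <_) (sym (weight-2⁻ s)) (2⁻-positive (length s))

weight-++ : ∀ s t → weight (s ++ t) ≡ weight s * weight t
weight-++ []      t = sym (*-identityˡ (weight t))
weight-++ (_ ∷ s) t = trans (cong (½ *_) (weight-++ s t)) (sym (*-assoc ½ (weight s) (weight t)))

Σ< : ℕ → (ℕ → ℚ) → ℚ
Σ< n f = foldr _+_ 0ℚ (applyUpTo f n)

Σ-mono : ∀ {f g} → (∀ i → f i ≤ g i) → ∀ n → Σ< n f ≤ Σ< n g
Σ-mono f≤g zero    = ≤-refl
Σ-mono f≤g (suc n) = +-mono-≤ (f≤g 0) (Σ-mono (λ i → f≤g (suc i)) n)

Σ-+ : ∀ f g n → Σ< n (λ i → f i + g i) ≡ Σ< n f + Σ< n g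
Σ-+ f g zero    = refl
Σ-+ f g (suc n) = trans (cong (f 0 + g 0 +_) (Σ-+ _ _ n))
  (solve 4 (λ a b c d → a :+ b :+ (c :+ d) := a :+ c :+ (b :+ d)) refl
     (f 0) (g 0) (Σ< n (λ i → f (suc i))) (Σ< n (λ i → g (suc i))))

Σ-* : ∀ a f n → Σ< n (λ i → a * f i) ≡ a * Σ< n f
Σ-* a f zero    = sym (*-zeroʳ a)
Σ-* a f (suc n) = trans (cong (a * f 0 +_) (Σ-* a _ n)) (sym (*-distribˡ-+ a (f 0) _))

Σ-split : ∀ f m n → Σ< (m ℕ.+ n) f ≡ Σ< m f + Σ< n (λ i → f (m ℕ.+ i))
Σ-split f zero    n = sym (+-identityˡ (Σ< n f))
Σ-split f (suc m) n = trans (cong (f 0 +_) (Σ-split _ m n)) (sym (+-assoc (f 0) _ _))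

Σ-nonneg : ∀ {f} → (∀ i → 0ℚ ≤ f i) → ∀ n → 0ℚ ≤ Σ< n f
Σ-nonneg 0≤f zero    = ≤-refl
Σ-nonneg 0≤f (suc n) = +-mono-≤ (0≤f 0) (Σ-nonneg (λ i → 0≤f (suc i)) n)

Σ-monoˡ : ∀ f → (∀ i → 0ℚ ≤ f i) → ∀ {m n} → m ℕ.≤ n → Σ< m f ≤ Σ< n f
Σ-monoˡ f 0≤f {n = n} ℕ.z≤n     = Σ-nonneg 0≤f n
Σ-monoˡ f 0≤f         (ℕ.s≤s m≤n) = +-monoʳ-≤ (f 0) (Σ-monoˡ (λ i → f (suc i)) (λ i → 0≤f (suc i)) m≤n)

term≤Σ : ∀ {f} → (∀ i → 0ℚ ≤ f i) → ∀ i → f i ≤ Σ< (suc i) f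
term≤Σ {f} 0≤f zero    = ≤-reflexive (sym (+-identityʳ (f 0)))
term≤Σ {f} 0≤f (suc i) = ≤-trans (term≤Σ (λ j → 0≤f (suc j)) i)
  (subst (_≤ Σ< (suc (suc i)) f) (+-identityˡ _) (+-monoˡ-≤ (Σ< (suc i) (λ j → f (suc j))) (0≤f 0)))

Σ-2⁻ : ∀ m n → Σ< n (λ i → 2⁻ (m ℕ.+ suc i)) + 2⁻ (m ℕ.+ n) ≡ 2⁻ m
Σ-2⁻ m zero    = trans (+-identityˡ _) (cong 2⁻_ (ℕ.+-identityʳ m))
Σ-2⁻ m (suc n) = begin
  2⁻ (m ℕ.+ 1) + Σ< n (λ i → 2⁻ (m ℕ.+ suc (suc i))) + 2⁻ (m ℕ.+ suc n)
    ≡⟨ cong₂ (λ s k → 2⁻ (m ℕ.+ 1) + s + 2⁻ k) (shift n (λ i → ℕ.+-suc m (suc i))) (ℕ.+-suc m n) ⟩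
  2⁻ (m ℕ.+ 1) + Σ< n (λ i → 2⁻ (suc m ℕ.+ suc i)) + 2⁻ (suc m ℕ.+ n)
    ≡⟨ +-assoc (2⁻ (m ℕ.+ 1)) _ _ ⟩
  2⁻ (m ℕ.+ 1) + (Σ< n (λ i → 2⁻ (suc m ℕ.+ suc i)) + 2⁻ (suc m ℕ.+ n))
    ≡⟨ cong₂ _+_ (cong 2⁻_ (ℕ.+-comm m 1)) (Σ-2⁻ (suc m) n) ⟩
  ½ * 2⁻ m + ½ * 2⁻ m
    ≡⟨ solve 1 (λ a → con ½ :* a :+ con ½ :* a := a) refl (2⁻ m) ⟩
  2⁻ m ∎
  where
  open ≡-Reasoning
  shift : ∀ n {f g : ℕ → ℕ} → (∀ i → f i ≡ g i) → Σ< n (λ i → 2⁻ f i) ≡ Σ< n (λ i → 2⁻ g i)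
  shift zero    f≗g = refl
  shift (suc n) f≗g = cong₂ _+_ (cong 2⁻_ (f≗g 0)) (shift n (λ i → f≗g (suc i)))

Σ-2⁻≤ : ∀ m n → Σ< n (λ i → 2⁻ (m ℕ.+ suc i)) ≤ 2⁻ m
Σ-2⁻≤ m n = subst (Σ< n (λ i → 2⁻ (m ℕ.+ suc i)) ≤_) (Σ-2⁻ m n) (p≤p+q (<⇒≤ (2⁻-positive (m ℕ.+ n))))

module _ {A : Set} where

  interleave : (ℕ → A) → (ℕ → A) → ℕ → A
  interleave f g zero    = f zero
  interleave f g (suc n) = interleave g (λ i → f (suc i)) n

  interleave-left : ∀ f g i → ∃[ j ] interleave f g j ≡ f i
  interleave-right : ∀ f g i → ∃[ j ] interleave f g j ≡ g i
  interleave-left f g zero    = 0 , refl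
  interleave-left f g (suc i) with interleave-right g (λ i → f (suc i)) i
  ... | j , eq = suc j , eq
  interleave-right f g i with interleave-left g (λ i → f (suc i)) i
  ... | j , eq = suc j , eq

  Σ-interleave : (w : A → ℚ) → (∀ a → 0ℚ ≤ w a) → ∀ f g n →
    Σ< n (λ i → w (interleave f g i)) ≤ Σ< n (λ i → w (f i)) + Σ< n (λ i → w (g i))
  Σ-interleave w 0≤w f g zero    = ≤-refl
  Σ-interleave w 0≤w f g (suc n) = ≤-from
    (+-mono-≤ (Σ-interleave w 0≤w g (λ i → f (suc i)) n)
              (Σ-monoˡ (λ i → w (g i)) (λ i → 0≤w (g i)) (ℕ.n≤1+n n)))
    (solve 5 (λ a i g f g′ → a :+ i :+ (g :+ f :+ g′) := a :+ f :+ g′ :+ (i :+ g)) refl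
      (w (f 0)) (Σ< n (λ i → w (interleave g (λ i → f (suc i)) i)))
      (Σ< n (λ i → w (g i))) (Σ< n (λ i → w (f (suc i)))) (Σ< (suc n) (λ i → w (g i))))

-- Approximate suprema

module _ (em : ExcludedMiddle 0ℓ) where

  ¬∀⇒∃¬ : {A : Set} {P : A → Set} → ¬ (∀ a → P a) → ∃[ a ] ¬ P a
  ¬∀⇒∃¬ {P = P} ¬∀ with em {∃[ a ] ¬ P a}
  ... | yes ∃¬ = ∃¬
  ... | no ¬∃¬ = contradiction decide ¬∀
    where
    decide : ∀ a → P a
    decide a with em {P a}
    ... | yes p = p
    ... | no ¬p = contradiction (a , ¬p) ¬∃¬

  -- A cut need not have a rational endpoint, so it is located only up to `η`. Halving the interval
  -- n times leaves the length ℓ · 2⁻ n, which is below `η` once 2⁻ n is below η / ℓ.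
  bisect : (P : ℚ → Set) → (∀ {p q} → p ≤ q → P p → P q) → ∀ {a b} → a < b → ¬ P a → P b →
    ∀ {η} → 0ℚ < η → ∃[ p ] (¬ P p × P (p + η))
  bisect P P-up {a} {b} a<b ¬Pa Pb {η} 0<η =
    let p , ¬Pp , Pq = halvings (proj₁ small)
    in p , ¬Pp , P-up (+-monoʳ-≤ p (<⇒≤ (subst (ℓ * 2⁻ proj₁ small <_)
         (trans (sym (*-assoc ℓ (1/ ℓ) η)) (trans (cong (_* η) (*-inverseʳ ℓ)) (*-identityˡ η)))
         (*-monoʳ-< ℓ 0<ℓ (proj₂ small))))) Pq
    where
    ℓ = b - a
    0<ℓ : 0ℚ < ℓ
    0<ℓ = <-from a<b (solve 2 (λ a b → con 0ℚ :+ b := b :- a :+ a) refl a b)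
    instance
      ℓ-positive : Positive ℓ
      ℓ-positive = positive 0<ℓ
      ℓ-nonZero = pos⇒nonZero ℓ
    small : ∃[ n ] 2⁻ n < 1/ ℓ * η
    small = 2⁻-small (*-positive (positive⁻¹ (1/ ℓ) {{1/pos⇒pos ℓ}}) 0<η)
    halvings : ∀ n → ∃[ p ] (¬ P p × P (p + ℓ * 2⁻ n))
    halvings zero = a , ¬Pa ,
      subst P (solve 2 (λ a b → b := a :+ (b :- a) :* con 1ℚ) refl a b) Pb
    halvings (suc n) with halvings n
    ... | p , ¬Pp , Pq with em {P (p + ℓ * 2⁻ suc n)}
    ...   | yes Pm = p , ¬Pp , Pm
    ...   | no ¬Pm = p + ℓ * 2⁻ suc n , ¬Pm ,
            subst P (solve 3 (λ p l x → p :+ l :* x :=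
              p :+ l :* (con ½ :* x) :+ l :* (con ½ :* x)) refl p ℓ (2⁻ n)) Pq

  near-supremum : ∀ (f : ℕ → ℚ) {b} → 0ℚ ≤ f 0 → (∀ n → f n ≤ b) → ∀ {η} → 0ℚ < η →
    ∃[ a ] ((∀ n → f n ≤ a + η) × ∃[ n ] a < f n)
  near-supremum f {b} 0≤f0 f≤b 0<η =
    let a , ¬f≤a , f≤a+η = bisect (λ a → ∀ n → f n ≤ a) (λ p≤q f≤p n → ≤-trans (f≤p n) p≤q)
                             -1<b (λ f≤-1 → <-irrefl refl (<-≤-trans -1<0 (≤-trans 0≤f0 (f≤-1 0)))) f≤b 0<η
        n , fn≰a = ¬∀⇒∃¬ ¬f≤a
    in a , f≤a+η , n , ≰⇒> fn≰a
    where
    -1<0 : - 1ℚ < 0ℚ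
    -1<0 = negative⁻¹ (- 1ℚ)
    -1<b : - 1ℚ < b
    -1<b = <-≤-trans -1<0 (≤-trans 0≤f0 (f≤b 0))

  -- At some n₀ the value of `f` exceeds `a`, which is within `η` of an upper bound of `f`. From n₀
  -- on the joint bound leaves at most r - a for `g`, and monotonicity extends this to smaller n.
  split-bound : ∀ (f g : ℕ → ℚ) {r} → (∀ {m n} → m ℕ.≤ n → f m ≤ f n) → (∀ {m n} → m ℕ.≤ n → g m ≤ g n) →
    0ℚ ≤ f 0 → 0ℚ ≤ g 0 → (∀ n → f n + g n ≤ r) → ∀ {η} → 0ℚ < η →
    ∃[ a ] ∃[ b ] (a + b ≤ r + η × (∀ n → f n ≤ a) × (∀ n → g n ≤ b))
  split-bound f g {r} f-mono g-mono 0≤f0 0≤g0 f+g≤r {η} 0<η =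
    let a , f≤a+η , n₀ , a<f = near-supremum f 0≤f0 f≤r 0<η
    in a + η , r - a ,
       ≤-reflexive (solve 3 (λ a e r → a :+ e :+ (r :- a) := r :+ e) refl a η r) ,
       f≤a+η ,
       λ n → ≤-from (+-mono-≤ (f+g≤r (n ℕ.⊔ n₀)) (+-mono-≤ (g-mono {n} {n ℕ.⊔ n₀} (ℕ.m≤m⊔n n n₀))
                      (≤-trans (<⇒≤ a<f) (f-mono {n₀} {n ℕ.⊔ n₀} (ℕ.m≤n⊔m n n₀)))))
              (solve 5 (λ gn r gm fm a → gn :+ (r :+ (gm :+ fm)) := r :- a :+ (fm :+ gm :+ (gn :+ a))) refl
                (g n) r (g (n ℕ.⊔ n₀)) (f (n ℕ.⊔ n₀)) a)
    where
    f≤r : ∀ n → f n ≤ r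
    f≤r n = ≤-from (+-mono-≤ (f+g≤r n) (≤-trans 0≤g0 (g-mono {0} {n} ℕ.z≤n)))
              (solve 3 (λ f r g → f :+ (r :+ g) := r :+ (f :+ g :+ con 0ℚ)) refl (f n) r (g n))

-- Outer measure

drop : ℕ → Cantor → Cantor
drop m x n = x (m ℕ.+ n)

tail : Cantor → Cantor
tail = drop 1

N-∷⁺ : ∀ {b s x} → x 0 ≡ b → N s (tail x) → N (b ∷ s) x
N-∷⁺ = cong₂ _∷_

N-∷⁻ : ∀ {b s x} → N (b ∷ s) x → x 0 ≡ b × N s (tail x)
N-∷⁻ = ∷-injective

N-++ : ∀ s {t x} → N s x → N t (drop (length s) x) → N (s ++ t) x
N-++ []      _  nt = nt
N-++ (b ∷ s) {t} {x} ns nt = N-∷⁺ {b} {s ++ t} {x} (proj₁ split) (N-++ s (proj₂ split) nt)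
  where split = N-∷⁻ {b} {s} {x} ns

Cyl : Maybe (List Bool) → Subset
Cyl nothing  = ∅
Cyl (just s) = N s

wt : Maybe (List Bool) → ℚ
wt nothing  = 0ℚ
wt (just s) = weight s

0≤wt : ∀ c → 0ℚ ≤ wt c
0≤wt nothing  = ≤-refl
0≤wt (just s) = <⇒≤ (weight-positive s)

-- Cov A r says μ(A) ≤ r, witnessed by one cover.  Indices may be left unused,
-- so that a cover can be restricted to a part of the space without reindexing.
Cov : Subset → ℚ → Set
Cov A r = ∃ λ (c : ℕ → Maybe (List Bool)) →
  (∀ x → A x → ∃[ i ] Cyl (c i) x) × (∀ n → Σ< n (λ i → wt (c i)) ≤ r)

μ⇒Cov : ∀ {A q} → μ[ A ]< q → ∃[ r ] (r < q × Cov A r)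
μ⇒Cov (c , A⊆c , r , r<q , Σ≤r) = r , r<q , (λ i → just (c i)) , (λ x → A⊆c) , Σ≤r

-- Unused indices are filled with cylinders of total weight less than q - r.
Cov⇒μ : ∀ {A r q} → Cov A r → r < q → μ[ A ]< q
Cov⇒μ {A} {r} {q} (c , A⊆c , Σ≤r) r<q =
  (λ i → fill i (c i)) , (λ {x} x∈A → filled (A⊆c x x∈A)) ,
  r + 2⁻ m , r+2⁻m<q ,
  λ n → ≤-trans (Σ-mono (λ i → weight-fill i (c i)) n)
    (≤-trans (≤-reflexive (Σ-+ (λ i → wt (c i)) (λ i → 2⁻ (m ℕ.+ suc i)) n))
      (+-mono-≤ (Σ≤r n) (Σ-2⁻≤ m n)))
  where
  0<q-r : 0ℚ < q - r
  0<q-r = <-from r<q (solve 2 (λ q r → con 0ℚ :+ q := q :- r :+ r) refl q r)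
  m : ℕ
  m = proj₁ (2⁻-small 0<q-r)
  r+2⁻m<q : r + 2⁻ m < q
  r+2⁻m<q = <-from (proj₂ (2⁻-small 0<q-r)) (solve 3 (λ r q e → r :+ e :+ (q :- r) := q :+ e) refl r q (2⁻ m))
  fill : ℕ → Maybe (List Bool) → List Bool
  fill i nothing  = replicate (m ℕ.+ suc i) false
  fill i (just s) = s
  filled : ∀ {x} → ∃[ i ] Cyl (c i) x → ∃[ i ] N (fill i (c i)) x
  filled (i , x∈c) with c i in eq
  ... | just s = i , subst (λ d → N (fill i d) _) (sym eq) x∈c
  weight-fill : ∀ i d → weight (fill i d) ≤ wt d + 2⁻ (m ℕ.+ suc i)
  weight-fill i nothing  = ≤-reflexive (trans (trans (weight-2⁻ (replicate (m ℕ.+ suc i) false))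
    (cong 2⁻_ (length-replicate (m ℕ.+ suc i)))) (sym (+-identityˡ (2⁻ (m ℕ.+ suc i)))))
  weight-fill i (just s) = p≤p+q (<⇒≤ (2⁻-positive (m ℕ.+ suc i)))

Cov-nonneg : ∀ {A r} → Cov A r → 0ℚ ≤ r
Cov-nonneg (_ , _ , Σ≤r) = Σ≤r 0

Cov-mono : ∀ {A B r r′} → (∀ x → A x → B x) → r ≤ r′ → Cov B r → Cov A r′
Cov-mono A⊆B r≤r′ (c , B⊆c , Σ≤r) = c , (λ x x∈A → B⊆c x (A⊆B x x∈A)) , λ n → ≤-trans (Σ≤r n) r≤r′

Cov-∅ : ∀ {A} → (∀ x → ¬ A x) → Cov A 0ℚ
Cov-∅ A-empty = (λ _ → nothing) , (λ x x∈A → ⊥-elim (A-empty x x∈A)) , zeros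
  where
  zeros : ∀ n → Σ< n (λ _ → 0ℚ) ≤ 0ℚ
  zeros zero    = ≤-refl
  zeros (suc n) = subst (_≤ 0ℚ) (sym (+-identityˡ (Σ< n (λ _ → 0ℚ)))) (zeros n)

Cov-N : ∀ s → Cov (N s) (weight s)
Cov-N s = c , (λ x x∈N → 0 , x∈N) , Σ≤
  where
  c : ℕ → Maybe (List Bool)
  c zero    = just s
  c (suc _) = nothing
  Σ≤ : ∀ n → Σ< n (λ i → wt (c i)) ≤ weight s
  Σ≤ zero    = <⇒≤ (weight-positive s)
  Σ≤ (suc n) = subst (weight s + Σ< n (λ _ → 0ℚ) ≤_) (+-identityʳ (weight s))
    (+-monoʳ-≤ (weight s) (proj₂ (proj₂ (Cov-∅ {∅} (λ _ ()))) n))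

Cov-U : ∀ {A} → Cov A 1ℚ
Cov-U = Cov-mono (λ _ _ → refl) ≤-refl (Cov-N [])

Cov-∪ : ∀ {A B C a b} → (∀ x → C x → A x ⊎ B x) → Cov A a → Cov B b → Cov C (a + b)
Cov-∪ C⊆A∪B (c , A⊆c , Σc≤a) (d , B⊆d , Σd≤b) =
  interleave c d ,
  (λ x x∈C → [ (λ x∈A → left (A⊆c x x∈A)) , (λ x∈B → right (B⊆d x x∈B)) ]′ (C⊆A∪B x x∈C)) ,
  λ n → ≤-trans (Σ-interleave wt 0≤wt c d n) (+-mono-≤ (Σc≤a n) (Σd≤b n))
  where
  left : ∀ {x} → ∃[ i ] Cyl (c i) x → ∃[ i ] Cyl (interleave c d i) x
  left (i , p) with interleave-left c d i
  ... | j , eq = j , subst (λ e → Cyl e _) (sym eq) p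
  right : ∀ {x} → ∃[ i ] Cyl (d i) x → ∃[ i ] Cyl (interleave c d i) x
  right (i , p) with interleave-right c d i
  ... | j , eq = j , subst (λ e → Cyl e _) (sym eq) p

Cov-lift : ∀ {R A r} t → (∀ x → A x → N t x × R (drop (length t) x)) → Cov R r → Cov A (weight t * r)
Cov-lift {R} {A} {r} t A⊆tR (c , R⊆c , Σ≤r) =
  (λ i → map (t ++_) (c i)) ,
  (λ x x∈A → prefixed (proj₁ (A⊆tR x x∈A)) (R⊆c _ (proj₂ (A⊆tR x x∈A)))) ,
  λ n → ≤-trans (Σ-mono (λ i → ≤-reflexive (wt-map (c i))) n)
    (subst (_≤ weight t * r) (sym (Σ-* (weight t) (λ i → wt (c i)) n))
      (*-monoʳ-≤ (weight t) (<⇒≤ (weight-positive t)) (Σ≤r n)))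
  where
  wt-map : ∀ d → wt (map (t ++_) d) ≡ weight t * wt d
  wt-map nothing  = sym (*-zeroʳ (weight t))
  wt-map (just s) = weight-++ t s
  prefixed : ∀ {x} → N t x → ∃[ i ] Cyl (c i) (drop (length t) x) → ∃[ i ] Cyl (map (t ++_) (c i)) x
  prefixed {x} x∈t (i , p) = i , go (c i) p
    where
    go : ∀ d → Cyl d (drop (length t) x) → Cyl (map (t ++_) d) x
    go (just s) p = N-++ t x∈t p

-- The points y with b y ∈ A; since A need not respect pointwise equality, y has
-- to be the tail of a point of A.
Tail : Bool → Subset → Subset
Tail b A y = ∃[ x ] (A x × x 0 ≡ b × tail x ≡ y)

Cov-join : ∀ {A a b} → Cov (Tail false A) a → Cov (Tail true A) b → Cov A (½ * a + ½ * b)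
Cov-join {A} {a} {b} c₀ c₁ = subst (Cov A) (cong₂ (λ u v → u * a + v * b) (*-identityʳ ½) (*-identityʳ ½))
  (Cov-∪ split (Cov-lift (false ∷ []) (λ x p → p) c₀) (Cov-lift (true ∷ []) (λ x p → p) c₁))
  where
  split : ∀ x → A x → (N (false ∷ []) x × Tail false A (tail x)) ⊎ (N (true ∷ []) x × Tail true A (tail x))
  split x x∈A with x 0 in eq
  ... | false = inj₁ (refl , x , x∈A , eq , refl)
  ... | true  = inj₂ (refl , x , x∈A , eq , refl)

-- The trace of a cylinder on the half `b`, rescaled to the whole space. Rescaling doubles measures,
-- so the two traces together weigh twice the original cylinder.
residual : Bool → Maybe (List Bool) → Maybe (List Bool)
residual b nothing         = nothing
residual b (just [])       = just []
residual b (just (b′ ∷ s)) with b Bool.≟ b′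
... | yes _ = just s
... | no _  = nothing

residual-∷ : ∀ b s → residual b (just (b ∷ s)) ≡ just s
residual-∷ b s with b Bool.≟ b
... | yes _   = refl
... | no b≢b = contradiction refl b≢b

wt-residual : ∀ c → wt (residual false c) + wt (residual true c) ≡ wt c + wt c
wt-residual nothing            = refl
wt-residual (just [])          = refl
wt-residual (just (false ∷ s)) = solve 1 (λ w → w :+ con 0ℚ := con ½ :* w :+ con ½ :* w) refl (weight s)
wt-residual (just (true ∷ s))  = solve 1 (λ w → con 0ℚ :+ w := con ½ :* w :+ con ½ :* w) refl (weight s)

Cyl-residual : ∀ d {x} → Cyl d x → Cyl (residual (x 0) d) (tail x)
Cyl-residual (just [])      p = refl
Cyl-residual (just (b ∷ s)) {x} p with N-∷⁻ {b} {s} {x} p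
... | refl , q = subst (λ e → Cyl e (tail x)) (sym (residual-∷ (x 0) s)) q

Σ-residual : ∀ c n → Σ< n (λ i → wt (residual false (c i))) + Σ< n (λ i → wt (residual true (c i)))
  ≡ Σ< n (λ i → wt (c i)) + Σ< n (λ i → wt (c i))
Σ-residual c zero    = refl
Σ-residual c (suc n) = trans
  (swap (wt (residual false (c 0))) (Σ< n (λ i → wt (residual false (c (suc i))))) (wt (residual true (c 0))) (Σ< n (λ i → wt (residual true (c (suc i))))))
  (trans (cong₂ _+_ (wt-residual (c 0)) (Σ-residual (λ i → c (suc i)) n))
    (swap (wt (c 0)) (wt (c 0)) (Σ< n (λ i → wt (c (suc i)))) (Σ< n (λ i → wt (c (suc i))))))
  where
  swap : ∀ p q r s → p + q + (r + s) ≡ p + r + (q + s)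
  swap = solve 4 (λ p q r s → p :+ q :+ (r :+ s) := p :+ r :+ (q :+ s)) refl

Covered-residual : ∀ (A : Subset) (c : ℕ → Maybe (List Bool)) → (∀ x → A x → ∃[ i ] Cyl (c i) x) →
  ∀ b y → Tail b A y → ∃[ i ] Cyl (residual b (c i)) y
Covered-residual A c A⊆c b y (x , x∈A , refl , refl) with A⊆c x x∈A
... | i , p = i , Cyl-residual (c i) {x} p

Cov-Tail : ∀ {A r} b → Cov A r → Cov (Tail b A) (r + r)
Cov-Tail {A} {r} b (c , A⊆c , Σ≤r) = (λ i → residual b (c i)) , Covered-residual A c A⊆c b , λ n → bound b n
  where
  0≤Σ : ∀ b n → 0ℚ ≤ Σ< n (λ i → wt (residual b (c i)))
  0≤Σ b = Σ-nonneg (λ i → 0≤wt (residual b (c i)))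
  bound : ∀ b n → Σ< n (λ i → wt (residual b (c i))) ≤ r + r
  bound false n = ≤-trans
    (≤-from (0≤Σ true n) (solve 2 (λ a b → a :+ b := a :+ b :+ con 0ℚ) refl (Σ< n (λ i → wt (residual false (c i)))) (Σ< n (λ i → wt (residual true (c i))))))
    (≤-trans (≤-reflexive (Σ-residual c n)) (+-mono-≤ (Σ≤r n) (Σ≤r n)))
  bound true n = ≤-trans
    (≤-from (0≤Σ false n) (solve 2 (λ a b → b :+ a := a :+ b :+ con 0ℚ) refl (Σ< n (λ i → wt (residual false (c i)))) (Σ< n (λ i → wt (residual true (c i))))))
    (≤-trans (≤-reflexive (Σ-residual c n)) (+-mono-≤ (Σ≤r n) (Σ≤r n)))

Tail-N : ∀ b s x → N s x → Tail b (N (b ∷ s)) x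
Tail-N b s x x∈s = (λ { zero → b ; (suc n) → x n }) , cong (b ∷_) x∈s , refl , refl

Cov-∁N : ∀ s → Cov (∁ (N s)) (1ℚ - weight s)
Cov-∁N []          = Cov-∅ (λ x x∉ → x∉ refl)
Cov-∁N (false ∷ s) = Cov-mono (λ _ p → p)
  (≤-reflexive (solve 1 (λ w → con ½ :* (con 1ℚ :- w) :+ con ½ :* con 1ℚ := con 1ℚ :- con ½ :* w) refl (weight s)))
  (Cov-join (Cov-mono (λ { y (x , x∉ , x0 , refl) y∈s → x∉ (N-∷⁺ {x = x} x0 y∈s) }) ≤-refl (Cov-∁N s)) Cov-U)
Cov-∁N (true ∷ s)  = Cov-mono (λ _ p → p)
  (≤-reflexive (solve 1 (λ w → con ½ :* con 1ℚ :+ con ½ :* (con 1ℚ :- w) := con 1ℚ :- con ½ :* w) refl (weight s)))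
  (Cov-join Cov-U (Cov-mono (λ { y (x , x∉ , x0 , refl) y∈s → x∉ (N-∷⁺ {x = x} x0 y∈s) }) ≤-refl (Cov-∁N s)))

module _ (em : ExcludedMiddle 0ℓ) where

  -- One cover serves both halves, so their costs are bounded jointly; two applications of
  -- `Cov-Tail` would only give 4r. The slack `η` pays for dividing one bound into two rational
  -- ones.
  Cov-halve : ∀ {A r} → Cov A r → ∀ {η} → 0ℚ < η →
    ∃[ a ] ∃[ b ] (a + b ≤ r + r + η × Cov (Tail false A) a × Cov (Tail true A) b)
  Cov-halve {A} {r} (c , A⊆c , Σ≤r) 0<η =
    let a , b , a+b≤ , Σ≤a , Σ≤b = split-bound em (Σres false) (Σres true)
          (λ m≤n → Σ-monoˡ (λ i → wt (residual false (c i))) (λ i → 0≤wt (residual false (c i))) m≤n)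
          (λ m≤n → Σ-monoˡ (λ i → wt (residual true (c i))) (λ i → 0≤wt (residual true (c i))) m≤n)
          ≤-refl ≤-refl
          (λ n → ≤-trans (≤-reflexive (Σ-residual c n)) (+-mono-≤ (Σ≤r n) (Σ≤r n))) 0<η
    in a , b , a+b≤ , ((λ i → residual false (c i)) , Covered-residual A c A⊆c false , Σ≤a) , ((λ i → residual true (c i)) , Covered-residual A c A⊆c true , Σ≤b)
    where
    Σres : Bool → ℕ → ℚ
    Σres b n = Σ< n (λ i → wt (residual b (c i)))

  -- If a cover of the whole space had total weight r < 1, then from every node one
  -- could go to a child in which the relative weight of the cover is at most r;
  -- the branch obtained this way lies in no cylinder of the cover.
  1≤Cov-U : ∀ {r} → Cov U r → 1ℚ ≤ r
  1≤Cov-U {r} (c , U⊆c , Σ≤r) with em {1ℚ ≤ r}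
  ... | yes 1≤r = 1≤r
  ... | no 1≰r  = ⊥-elim (avoid (proj₂ covered) refl)
    where
    Small : (ℕ → Maybe (List Bool)) → Set
    Small c = ∀ n → Σ< n (λ i → wt (c i)) ≤ r
    child : ∀ c → Small c → ∃[ b ] Small (λ i → residual b (c i))
    child c small with em {Small (λ i → residual false (c i))}
    ... | yes small₀ = false , small₀
    ... | no ¬small₀ with ¬∀⇒∃¬ em ¬small₀
    ...   | m , ≰r = true , λ n → ≤-trans (Σ-monoˡ (λ i → wt (residual true (c i))) (λ i → 0≤wt (residual true (c i))) (ℕ.m≤n⊔m m n))
              (≤-from (+-mono-≤ (≤-trans (<⇒≤ (≰⇒> ≰r)) (Σ-monoˡ (λ i → wt (residual false (c i))) (λ i → 0≤wt (residual false (c i))) (ℕ.m≤m⊔n m n)))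
                 (≤-trans (≤-reflexive (Σ-residual c (m ℕ.⊔ n))) (+-mono-≤ (small (m ℕ.⊔ n)) (small (m ℕ.⊔ n)))))
              (solve 3 (λ t f r → t :+ (f :+ (r :+ r)) := r :+ (r :+ (f :+ t))) refl
                (Σ< (m ℕ.⊔ n) (λ i → wt (residual true (c i)))) (Σ< (m ℕ.⊔ n) (λ i → wt (residual false (c i)))) r))
    path : ∀ c → Small c → Cantor
    path c small zero    = proj₁ (child c small)
    path c small (suc n) = path (λ i → residual (proj₁ (child c small)) (c i)) (proj₂ (child c small)) n
    avoids : ∀ s c small i → N s (path c small) → ¬ c i ≡ just s
    avoids []      c small i _ eq = 1≰r (≤-trans (subst (λ d → 1ℚ ≤ wt d) (sym eq) ≤-refl)
      (≤-trans (term≤Σ (λ i → 0≤wt (c i)) i) (small (suc i))))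
    avoids (b ∷ s) c small i p eq with N-∷⁻ {b} {s} {path c small} p
    ... | refl , q = avoids s _ (proj₂ (child c small)) i q
                       (trans (cong (residual (proj₁ (child c small))) eq) (residual-∷ (proj₁ (child c small)) s))
    covered : ∃[ i ] Cyl (c i) (path c Σ≤r)
    covered = U⊆c _ tt
    avoid : ∀ {i d} → Cyl d (path c Σ≤r) → ¬ c i ≡ d
    avoid {i} {just s} p eq = avoids s c Σ≤r i p eq

  -- Removing a bit of `s` doubles both the weight and the cost of a cover, which reduces the claim
  -- to the whole space. All lower bounds on densities rest on it.
  weight≤Cov-N : ∀ s {r} → Cov (N s) r → weight s ≤ r
  weight≤Cov-N []      cov = 1≤Cov-U (Cov-mono (λ _ _ → refl) ≤-refl cov)
  weight≤Cov-N (b ∷ s) {r} cov = ≤-from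
    (*-monoʳ-≤ ½ 0≤½ (weight≤Cov-N s (Cov-mono (Tail-N b s) ≤-refl (Cov-Tail b cov))))
    (solve 2 (λ w r → con ½ :* w :+ con ½ :* (r :+ r) := r :+ con ½ :* w) refl (weight s) r)

-- Clopen approximation

-- Clopen sets are kept as finite trees because the approximant later becomes part of a decision
-- tree.
data Clopen : Set where
  const : Bool → Clopen
  split : Clopen → Clopen → Clopen

⟦_⟧ : Clopen → Subset
⟦ const b   ⟧ x = b ≡ true
⟦ split s t ⟧ x = if x 0 then ⟦ t ⟧ (tail x) else ⟦ s ⟧ (tail x)

insert : List Bool → Clopen → Clopen
insert []          _           = const true
insert (false ∷ s) (const b)   = split (insert s (const b)) (const b)
insert (true ∷ s)  (const b)   = split (const b) (insert s (const b))
insert (false ∷ s) (split D E) = split (insert s D) E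
insert (true ∷ s)  (split D E) = split D (insert s E)

insert⁺ : ∀ s D x → N s x ⊎ ⟦ D ⟧ x → ⟦ insert s D ⟧ x
insert⁺ []          D           x _ = refl
insert⁺ (b ∷ s)     D           x (inj₁ p) with N-∷⁻ {b} {s} {x} p
insert⁺ (false ∷ s) (const _)   x (inj₁ p) | x0 , q rewrite x0 = insert⁺ s _ (tail x) (inj₁ q)
insert⁺ (true ∷ s)  (const _)   x (inj₁ p) | x0 , q rewrite x0 = insert⁺ s _ (tail x) (inj₁ q)
insert⁺ (false ∷ s) (split D E) x (inj₁ p) | x0 , q rewrite x0 = insert⁺ s _ (tail x) (inj₁ q)
insert⁺ (true ∷ s)  (split D E) x (inj₁ p) | x0 , q rewrite x0 = insert⁺ s _ (tail x) (inj₁ q)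
insert⁺ (false ∷ s) (const b)   x (inj₂ p) with x 0
... | false = insert⁺ s (const b) (tail x) (inj₂ p)
... | true  = p
insert⁺ (true ∷ s)  (const b)   x (inj₂ p) with x 0
... | false = p
... | true  = insert⁺ s (const b) (tail x) (inj₂ p)
insert⁺ (false ∷ s) (split D E) x (inj₂ p) with x 0
... | false = insert⁺ s D (tail x) (inj₂ p)
... | true  = p
insert⁺ (true ∷ s)  (split D E) x (inj₂ p) with x 0
... | false = p
... | true  = insert⁺ s E (tail x) (inj₂ p)

insert⁻ : ∀ s D x → ⟦ insert s D ⟧ x → N s x ⊎ ⟦ D ⟧ x
insert⁻ []          D           x _ = inj₁ refl
insert⁻ (false ∷ s) (const b)   x p with x 0
... | false = [ (λ q → inj₁ (cong (false ∷_) q)) , inj₂ ]′ (insert⁻ s (const b) (tail x) p)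
... | true  = inj₂ p
insert⁻ (true ∷ s)  (const b)   x p with x 0
... | false = inj₂ p
... | true  = [ (λ q → inj₁ (cong (true ∷_) q)) , inj₂ ]′ (insert⁻ s (const b) (tail x) p)
insert⁻ (false ∷ s) (split D E) x p with x 0
... | false = [ (λ q → inj₁ (cong (false ∷_) q)) , inj₂ ]′ (insert⁻ s D (tail x) p)
... | true  = inj₂ p
insert⁻ (true ∷ s)  (split D E) x p with x 0
... | false = inj₂ p
... | true  = [ (λ q → inj₁ (cong (true ∷_) q)) , inj₂ ]′ (insert⁻ s E (tail x) p)

union : (ℕ → List Bool) → ℕ → Clopen
union c zero    = const false
union c (suc n) = insert (c 0) (union (λ i → c (suc i)) n)

union⁻ : ∀ c n {x} → ⟦ union c n ⟧ x → ∃[ i ] N (c i) x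
union⁻ c (suc n) {x} p with insert⁻ (c 0) (union (λ i → c (suc i)) n) x p
... | inj₁ q = 0 , q
... | inj₂ q with union⁻ (λ i → c (suc i)) n q
...   | i , r = suc i , r

union⁺ : ∀ c n {x} → ∃[ i ] N (c i) x → ⟦ union c n ⟧ x ⊎ ∃[ i ] N (c (n ℕ.+ i)) x
union⁺ c zero    p           = inj₂ p
union⁺ c (suc n) (zero , p)  = inj₁ (insert⁺ (c 0) _ _ (inj₁ p))
union⁺ c (suc n) (suc i , p) with union⁺ (λ i → c (suc i)) n (i , p)
... | inj₁ q = inj₁ (insert⁺ (c 0) _ _ (inj₂ q))
... | inj₂ q = inj₂ q

module _ (em : ExcludedMiddle 0ℓ) where

  -- This `p` stands in for the real number μ(A), which is given only by its cuts.
  near-optimal : ∀ A {η} → 0ℚ < η → ∃[ p ] (¬ Cov A p × Cov A (p + η))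
  near-optimal A = bisect em (Cov A) (λ p≤q → Cov-mono (λ _ x∈A → x∈A) p≤q)
    -1<1 (λ cov → <-irrefl refl (<-≤-trans -1<0 (Cov-nonneg cov))) Cov-U
    where
    -1<0 : - 1ℚ < 0ℚ
    -1<0 = negative⁻¹ (- 1ℚ)
    -1<1 : - 1ℚ < 1ℚ
    -1<1 = <-trans -1<0 0<1

  -- When the first n weights come within `η` of a bound for all partial sums, the remaining
  -- cylinders weigh at most `η`, and they cover what the first n miss.
  finite-subcover : ∀ {A r} (c : ℕ → List Bool) → A CoveredBy c → (∀ n → partialSum c n ≤ r) →
    ∀ {η} → 0ℚ < η → ∃[ n ] Cov (A ∖ ⟦ union c n ⟧) η
  finite-subcover {A} c A⊆c Σ≤r {η} 0<η = rest (near-supremum em (partialSum c) ≤-refl Σ≤r 0<η)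
    where
    rest : ∃[ a ] ((∀ n → partialSum c n ≤ a + η) × ∃[ n ] a < partialSum c n) →
           ∃[ n ] Cov (A ∖ ⟦ union c n ⟧) η
    rest (a , Σ≤a+η , n , a<Σ) = n ,
      (λ i → just (c (n ℕ.+ i))) ,
      (λ { x (x∈A , x∉D) → [ (λ x∈D → contradiction x∈D x∉D) , (λ q → q) ]′ (union⁺ c n (A⊆c x∈A)) }) ,
      λ k → ≤-from (+-mono-≤ (≤-trans (≤-reflexive (sym (Σ-split (λ i → weight (c i)) n k))) (Σ≤a+η (n ℕ.+ k))) (<⇒≤ a<Σ))
              (solve 4 (λ t a e s → t :+ (a :+ e :+ s) := e :+ (s :+ t :+ a)) refl
                 (Σ< k (λ i → weight (c (n ℕ.+ i)))) a η (partialSum c n))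

  -- Carathéodory's criterion is tested on the clopen set D itself, which inherits the nearly
  -- optimal cover of A. Since D ∩ A uses up almost all of its cost, little is left for D ∖ A.
  clopen-approximation : ∀ {A} → Measurable A → ∀ {ε} → 0ℚ < ε → ∃[ D ] μ[ A △ ⟦ D ⟧ ]< ε
  clopen-approximation {A} measurable {ε} 0<ε = approximate (near-optimal A 0<η)
    where
    -- A ∖ D costs `η`. D ∖ A costs less than 3η: the cover may exceed `p` by 2η, and D ∩ A may fall
    -- short of `p` by `η`.
    η = ½ * (½ * ε)
    0<η : 0ℚ < η
    0<η = ½-positive (½-positive 0<ε)
    η<2η : η < η + η
    η<2η = subst (_< η + η) (+-identityʳ η) (+-monoʳ-< η 0<η)
    decide-∈ : ∀ (D : Subset) x → A x → (D ∩ A) x ⊎ (A ∖ D) x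
    decide-∈ D x x∈A with em {D x}
    ... | yes x∈D = inj₁ (x∈D , x∈A)
    ... | no x∉D  = inj₂ (x∈A , x∉D)
    arith : ∀ η {s r p r′ s′} → r′ + s′ ≡ p + (η + η) → p < r + η → r < r′ → s < s′ →
      η + s < η + η + (η + η)
    arith η {s} {r} {p} {r′} {s′} eq p<r+η r<r′ s<s′ =
      <-from (+-mono-< s<s′ (+-mono-< p<r+η r<r′))
        (trans (solve 6 (λ e s r p r′ s′ → e :+ s :+ (s′ :+ (r :+ e :+ r′)) := r′ :+ s′ :+ (e :+ e) :+ (s :+ r)) refl η s r p r′ s′)
          (trans (cong (λ q → q + (η + η) + (s + r)) eq)
            (solve 4 (λ e s r p → p :+ (e :+ e) :+ (e :+ e) :+ (s :+ r) := e :+ e :+ (e :+ e) :+ (s :+ (p :+ r))) refl η s r p)))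
    4η≡ε : η + η + (η + η) ≡ ε
    4η≡ε = solve 1 (λ e → con ½ :* (con ½ :* e) :+ con ½ :* (con ½ :* e) :+ (con ½ :* (con ½ :* e) :+ con ½ :* (con ½ :* e)) := e) refl ε

    combine : ∀ {p D q} → ¬ Cov A p → q ≡ p + (η + η) → Cov (A ∖ ⟦ D ⟧) η →
      (∃[ r ] ∃[ s ] (r + s ≡ q × μ[ ⟦ D ⟧ ∩ A ]< r × μ[ ⟦ D ⟧ ∖ A ]< s)) →
      μ[ A △ ⟦ D ⟧ ]< ε
    combine {p} {D} ¬Cov-p q≡ Cov-A∖D (r′ , s′ , r′+s′≡ , μ∩ , μ∖) = result (μ⇒Cov μ∩) (μ⇒Cov μ∖)
      where
      result : ∃[ r ] (r < r′ × Cov (⟦ D ⟧ ∩ A) r) → ∃[ s ] (s < s′ × Cov (⟦ D ⟧ ∖ A) s) → μ[ A △ ⟦ D ⟧ ]< ε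
      result (r , r<r′ , Cov-D∩A) (s , s<s′ , Cov-D∖A) =
        Cov⇒μ (Cov-∪ (λ _ x∈ → x∈) Cov-A∖D Cov-D∖A)
          (subst (η + s <_) 4η≡ε (arith η (trans r′+s′≡ q≡)
            (≰⇒> (λ r+η≤p → ¬Cov-p (Cov-mono (λ _ x∈A → x∈A) r+η≤p (Cov-∪ (decide-∈ ⟦ D ⟧) Cov-D∩A Cov-A∖D))))
            r<r′ s<s′))

    from-cover : ∀ {p} → ¬ Cov A p → μ[ A ]< (p + (η + η)) → ∃[ D ] μ[ A △ ⟦ D ⟧ ]< ε
    from-cover ¬Cov-p (c , A⊆c , r , r< , Σ≤r) = finish (finite-subcover c A⊆c Σ≤r 0<η)
      where
      finish : ∃[ n ] Cov (A ∖ ⟦ union c n ⟧) η → ∃[ D ] μ[ A △ ⟦ D ⟧ ]< ε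
      finish (n , Cov-A∖D) = union c n ,
        combine {D = union c n} ¬Cov-p refl Cov-A∖D (measurable ⟦ union c n ⟧ _ (c , union⁻ c n , r , r< , Σ≤r))

    approximate : ∃[ p ] (¬ Cov A p × Cov A (p + η)) → ∃[ D ] μ[ A △ ⟦ D ⟧ ]< ε
    approximate (p , ¬Cov-p , cov) = from-cover ¬Cov-p (Cov⇒μ cov (+-monoʳ-< p η<2η))

-- A rank for Π⁰₃ sets

infix 6 _⇂_
infix 4 _≻_

-- Finite sequences are also stored with the last bit first, so that extending a
-- sequence by one bit is consing.
_⇂_ : Cantor → ℕ → List Bool
x ⇂ zero  = []
x ⇂ suc n = x n ∷ x ⇂ n

_≻_ : Cantor → List Bool → Set
x ≻ u = x ⇂ length u ≡ u

length-⇂ : ∀ x n → length (x ⇂ n) ≡ n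
length-⇂ x zero    = refl
length-⇂ x (suc n) = cong suc (length-⇂ x n)

≻-⇂ : ∀ {x y n} → x ⇂ n ≡ y ⇂ n → x ≻ y ⇂ n
≻-⇂ {x} {y} {n} eq = trans (cong (x ⇂_) (length-⇂ y n)) eq

⇂-≤ : ∀ {x y m n} → m ℕ.≤ n → x ⇂ n ≡ y ⇂ n → x ⇂ m ≡ y ⇂ m
⇂-≤ {x} {y} m≤n = go (ℕ.≤⇒≤′ m≤n)
  where
  go : ∀ {m n} → m ℕ.≤′ n → x ⇂ n ≡ y ⇂ n → x ⇂ m ≡ y ⇂ m
  go (ℕ.≤′-reflexive refl) eq = eq
  go (ℕ.≤′-step m≤n)       eq = go m≤n (proj₂ (∷-injective eq))

Agree : ℕ → Cantor → Cantor → Set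
Agree n x y = ∀ i → i ℕ.< n → x i ≡ y i

⇂⇒Agree : ∀ {x y} n → x ⇂ n ≡ y ⇂ n → Agree n x y
⇂⇒Agree (suc n) eq i i<1+n with ℕ.m<1+n⇒m<n∨m≡n i<1+n
... | inj₁ i<n  = ⇂⇒Agree n (proj₂ (∷-injective eq)) i i<n
... | inj₂ refl = proj₁ (∷-injective eq)

Agree⇒⇂ : ∀ {x y} n → Agree n x y → x ⇂ n ≡ y ⇂ n
Agree⇒⇂ zero    _  = refl
Agree⇒⇂ (suc n) ag = cong₂ _∷_ (ag n ℕ.≤-refl) (Agree⇒⇂ n (λ i i<n → ag i (ℕ.m≤n⇒m≤1+n i<n)))

Agree⇒↾ : ∀ {x y} n → Agree n x y → x ↾ n ≡ y ↾ n
Agree⇒↾ zero    _  = refl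
Agree⇒↾ (suc n) ag = cong₂ _∷_ (ag 0 (ℕ.s≤s ℕ.z≤n)) (Agree⇒↾ n (λ i i<n → ag (suc i) (ℕ.s≤s i<n)))

↾⇒Agree : ∀ {x y} n → x ↾ n ≡ y ↾ n → Agree n x y
↾⇒Agree (suc n) eq zero    _             = proj₁ (∷-injective eq)
↾⇒Agree (suc n) eq (suc i) (ℕ.s≤s i<n) = ↾⇒Agree n (proj₂ (∷-injective eq)) i i<n

Agree⇒N : ∀ {x y} n → Agree n x y → N (x ↾ n) y
Agree⇒N {x} {y} n ag = trans (cong (y ↾_) (length-applyUpTo x n)) (sym (Agree⇒↾ n ag))

N⇒Agree : ∀ {x y} n → N (x ↾ n) y → Agree n x y
N⇒Agree {x} {y} n p = ↾⇒Agree n (sym (trans (cong (y ↾_) (sym (length-applyUpTo x n))) p))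

module _ (em : ExcludedMiddle 0ℓ) where

  closed-limit : ∀ {C} → IsClosed C → ∀ x → (∀ n → ∃[ y ] (C y × x ⇂ n ≡ y ⇂ n)) → C x
  closed-limit {C} closed x approx with em {C x}
  ... | yes x∈C = x∈C
  ... | no x∉C with closed x x∉C
  ...   | n , outside with approx n
  ...     | y , y∈C , eq = contradiction y∈C (outside (Agree⇒N n (⇂⇒Agree n eq)))

  -- Closed sets depend only on prefixes. This is needed where a branch of K gives back x only bit
  -- by bit.
  Π⁰₃-respects : ∀ {X} → IsΠ⁰₃ X → ∀ {x y} → (∀ i → x i ≡ y i) → X x → X y
  Π⁰₃-respects (F , closed , X⊆ , ⊆X) {x} {y} x≗y x∈X = ⊆X (λ m → transport m (X⊆ x∈X m))
    where
    transport : ∀ m → ∃[ n ] F m n x → ∃[ n ] F m n y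
    transport m (n , x∈F) = n , closed-limit (closed m n) y
      (λ k → x , x∈F , Agree⇒⇂ k (λ i _ → sym (x≗y i)))

  lead : (ℕ → Set) → ℕ → ℕ
  lead P zero    = 0
  lead P (suc n) with em {P 0}
  ... | yes _ = 0
  ... | no _  = suc (lead (λ m → P (suc m)) n)

  lead-≤ : ∀ P n → lead P n ℕ.≤ n
  lead-≤ P zero    = ℕ.z≤n
  lead-≤ P (suc n) with em {P 0}
  ... | yes _ = ℕ.z≤n
  ... | no _  = ℕ.s≤s (lead-≤ (λ m → P (suc m)) n)

  lead-stops : ∀ P n {m} → P m → lead P n ℕ.≤ m
  lead-stops P zero    Pm = ℕ.z≤n
  lead-stops P (suc n) Pm with em {P 0}
  lead-stops P (suc n)         Pm | yes _  = ℕ.z≤n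
  lead-stops P (suc n) {zero}  Pm | no ¬P0 = contradiction Pm ¬P0
  lead-stops P (suc n) {suc m} Pm | no _   = ℕ.s≤s (lead-stops (λ m → P (suc m)) n Pm)

  lead-continues : ∀ P n {M} → M ℕ.≤ n → (∀ m → m ℕ.< M → ¬ P m) → M ℕ.≤ lead P n
  lead-continues P n       {zero}  _             _  = ℕ.z≤n
  lead-continues P (suc n) {suc M} (ℕ.s≤s M≤n) ¬P with em {P 0}
  ... | yes P0 = contradiction P0 (¬P 0 (ℕ.s≤s ℕ.z≤n))
  ... | no _   = ℕ.s≤s (lead-continues (λ m → P (suc m)) n M≤n (λ m m<M → ¬P (suc m) (ℕ.s≤s m<M)))

  module Rank (F : ℕ → ℕ → Subset) (closed : ∀ m n → IsClosed (F m n)) where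

    Alive : ℕ → ℕ → List Bool → Set
    Alive m n u = ∃[ y ] (F m n y × y ≻ u)

    -- candidate m u is the current guess for an n with x ∈ F m n, where u is an
    -- initial segment of x; it is given up when u leaves F m n.
    candidate : ℕ → List Bool → ℕ
    candidate m []      = 0
    candidate m (b ∷ u) with em {Alive m (candidate m u) (b ∷ u)}
    ... | yes _ = candidate m u
    ... | no _  = suc (candidate m u)

    Changes : ℕ → List Bool → Set
    Changes m []      = ⊥
    Changes m (b ∷ u) = ¬ Alive m (candidate m u) (b ∷ u)

    -- The least m whose candidate is given up at `u`, truncated at the length. The truncation still
    -- lets the rank tend to infinity when each candidate changes only finitely often.
    rank : List Bool → ℕ
    rank u = lead (λ m → Changes m u) (length u)

    candidate-suc : ∀ m b u → Changes m (b ∷ u) → candidate m (b ∷ u) ≡ suc (candidate m u)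
    candidate-suc m b u dead with em {Alive m (candidate m u) (b ∷ u)}
    ... | yes alive = contradiction alive dead
    ... | no _      = refl

    candidate-const : ∀ m b u → ¬ Changes m (b ∷ u) → candidate m (b ∷ u) ≡ candidate m u
    candidate-const m b u ¬dead with em {Alive m (candidate m u) (b ∷ u)}
    ... | yes _   = refl
    ... | no dead = contradiction dead ¬dead

    candidate-mono : ∀ m x {j k} → j ℕ.≤ k → candidate m (x ⇂ j) ℕ.≤ candidate m (x ⇂ k)
    candidate-mono m x j≤k = go (ℕ.≤⇒≤′ j≤k)
      where
      step : ∀ k → candidate m (x ⇂ k) ℕ.≤ candidate m (x ⇂ suc k)
      step k with em {Alive m (candidate m (x ⇂ k)) (x ⇂ suc k)}
      ... | yes _ = ℕ.≤-refl
      ... | no _  = ℕ.n≤1+n _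
      go : ∀ {j k} → j ℕ.≤′ k → candidate m (x ⇂ j) ℕ.≤ candidate m (x ⇂ k)
      go (ℕ.≤′-reflexive refl)      = ℕ.≤-refl
      go (ℕ.≤′-step {n = k} j≤k) = ℕ.≤-trans (go j≤k) (step k)

    -- A candidate that has reached n is never given up, since x itself keeps `F m n` alive.
    candidate-bound : ∀ m n x → F m n x → ∀ k → candidate m (x ⇂ k) ℕ.≤ n
    candidate-bound m n x x∈F zero    = ℕ.z≤n
    candidate-bound m n x x∈F (suc k) with em {Alive m (candidate m (x ⇂ k)) (x ⇂ suc k)}
    ... | yes _   = candidate-bound m n x x∈F k
    ... | no dead = ℕ.≤∧≢⇒< (candidate-bound m n x x∈F k)
      (λ eq → dead (subst (λ c → Alive m c (x ⇂ suc k)) (sym eq) (x , x∈F , ≻-⇂ {x} {x} {suc k} refl)))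

    finitely-many-changes : ∀ m n x → F m n x → ∃[ k₀ ] (∀ k → k₀ ℕ.≤ k → ¬ Changes m (x ⇂ k))
    finitely-many-changes m n x x∈F with em {∃[ k₀ ] (∀ k → k₀ ℕ.≤ k → ¬ Changes m (x ⇂ k))}
    ... | yes finite = finite
    ... | no infinite = contradiction (candidate-bound m n x x∈F (proj₁ (unbounded (suc n))))
                          (ℕ.<⇒≱ (proj₂ (unbounded (suc n))))
      where
      later : ∀ k₀ → ∃[ k ] (k₀ ℕ.≤ k × Changes m (x ⇂ k))
      later k₀ with em {∃[ k ] (k₀ ℕ.≤ k × Changes m (x ⇂ k))}
      ... | yes p = p
      ... | no ¬p = contradiction (k₀ , λ k k₀≤k dead → ¬p (k , k₀≤k , dead)) infinite
      unbounded : ∀ j → ∃[ k ] j ℕ.≤ candidate m (x ⇂ k)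
      unbounded zero    = 0 , ℕ.z≤n
      unbounded (suc j) with unbounded j
      ... | k , j≤ with later (suc k)
      ...   | suc k′ , ℕ.s≤s k≤k′ , dead = suc k′ , ℕ.≤-trans
                (ℕ.s≤s (ℕ.≤-trans j≤ (candidate-mono m x k≤k′)))
                (ℕ.≤-reflexive (sym (candidate-suc m (x k′) (x ⇂ k′) dead)))

    -- A candidate c that no longer changes is alive at all later prefixes, so x is a limit of
    -- points of the closed set `F m c`.
    infinitely-many-changes : ∀ m x → ¬ (∃[ n ] F m n x) → ∀ k₀ → ∃[ k ] (k₀ ℕ.≤ k × Changes m (x ⇂ k))
    infinitely-many-changes m x x∉ k₀ with em {∃[ k ] (k₀ ℕ.≤ k × Changes m (x ⇂ k))}
    ... | yes p = p
    ... | no ¬p = contradiction (c , closed-limit (closed m c) x approx) x∉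
      where
      c : ℕ
      c = candidate m (x ⇂ k₀)
      stable : ∀ j → candidate m (x ⇂ (j ℕ.+ k₀)) ≡ c
      stable zero    = refl
      stable (suc j) = trans (candidate-const m (x (j ℕ.+ k₀)) (x ⇂ (j ℕ.+ k₀))
        (λ dead → ¬p (suc (j ℕ.+ k₀) , ℕ.m≤n+m k₀ (suc j) , dead))) (stable j)
      alive : ∀ j → Alive m c (x ⇂ suc (j ℕ.+ k₀))
      alive j with em {Alive m c (x ⇂ suc (j ℕ.+ k₀))}
      ... | yes a = a
      ... | no dead = contradiction (suc (j ℕ.+ k₀) , ℕ.m≤n+m k₀ (suc j) ,
                        subst (λ c → ¬ Alive m c (x ⇂ suc (j ℕ.+ k₀))) (sym (stable j)) dead) ¬p
      approx : ∀ n → ∃[ y ] (F m c y × x ⇂ n ≡ y ⇂ n)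
      approx n with alive n
      ... | y , y∈F , y≻ = y , y∈F , ⇂-≤ {x} {y} (ℕ.m≤n⇒m≤1+n (ℕ.m≤m+n n k₀))
              (sym (trans (cong (y ⇂_) (sym (length-⇂ x (suc (n ℕ.+ k₀))))) y≻))

    rank-unbounded : ∀ x → (∀ m → ∃[ n ] F m n x) → ∀ M → ∃[ k₀ ] (∀ k → k₀ ℕ.≤ k → M ℕ.≤ rank (x ⇂ k))
    rank-unbounded x x∈ M = k₀ , λ k k₀≤k → lead-continues (λ m → Changes m (x ⇂ k)) (length (x ⇂ k))
      (subst (M ℕ.≤_) (sym (length-⇂ x k)) (ℕ.≤-trans (ℕ.m≤m⊔n M _) k₀≤k))
      (λ m m<M → proj₂ (quiet M) k (ℕ.≤-trans (ℕ.m≤n⊔m M _) k₀≤k) m m<M)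
      where
      quiet : ∀ M → ∃[ k₀ ] (∀ k → k₀ ℕ.≤ k → ∀ m → m ℕ.< M → ¬ Changes m (x ⇂ k))
      quiet zero    = 0 , λ _ _ _ ()
      quiet (suc M) with quiet M | finitely-many-changes M (proj₁ (x∈ M)) x (proj₂ (x∈ M))
      ... | k₁ , below | k₂ , at-M = k₁ ℕ.⊔ k₂ , both
        where
        both : ∀ k → k₁ ℕ.⊔ k₂ ℕ.≤ k → ∀ m → m ℕ.< suc M → ¬ Changes m (x ⇂ k)
        both k k₀≤k m m<1+M with ℕ.m<1+n⇒m<n∨m≡n m<1+M
        ... | inj₁ m<M  = below k (ℕ.≤-trans (ℕ.m≤m⊔n k₁ k₂) k₀≤k) m m<M
        ... | inj₂ refl = at-M k (ℕ.≤-trans (ℕ.m≤n⊔m k₁ k₂) k₀≤k)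
      k₀ : ℕ
      k₀ = M ℕ.⊔ proj₁ (quiet M)

    rank-bounded : ∀ x → ¬ (∀ m → ∃[ n ] F m n x) →
      ∃[ M ] (∀ k₀ → ∃[ k ] (k₀ ℕ.≤ k × rank (x ⇂ k) ℕ.≤ M))
    rank-bounded x x∉ with ¬∀⇒∃¬ em x∉
    ... | m , ¬∃n = m , λ k₀ → bounded (infinitely-many-changes m x ¬∃n k₀)
      where
      bounded : ∀ {k₀} → ∃[ k ] (k₀ ℕ.≤ k × Changes m (x ⇂ k)) → ∃[ k ] (k₀ ℕ.≤ k × rank (x ⇂ k) ℕ.≤ m)
      bounded (k , k₀≤k , dead) = k , k₀≤k , lead-stops (λ m → Changes m (x ⇂ k)) (length (x ⇂ k)) dead

  Π⁰₃-rank : ∀ {X} → IsΠ⁰₃ X → ∃ λ (φ : List Bool → ℕ) → (∀ u → φ u ℕ.≤ length u) ×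
    (∀ x → X x → ∀ M → ∃[ k₀ ] (∀ k → k₀ ℕ.≤ k → M ℕ.≤ φ (x ⇂ k))) ×
    (∀ x → ¬ X x → ∃[ M ] (∀ k₀ → ∃[ k ] (k₀ ℕ.≤ k × φ (x ⇂ k) ℕ.≤ M)))
  Π⁰₃-rank (F , closed , X⊆ , ⊆X) = rank ,
    (λ u → lead-≤ (λ m → Changes m u) (length u)) ,
    (λ x x∈X → rank-unbounded x (X⊆ x∈X)) ,
    (λ x x∉X → rank-bounded x (λ x∈ → x∉X (⊆X x∈)))
    where open Rank F closed

-- Decision trees

≻-∷⁻ : ∀ z b u → z ≻ (b ∷ u) → z (length u) ≡ b × z ≻ u
≻-∷⁻ _ _ _ = ∷-injective

inhabited : ∀ u → ∃[ z ] z ≻ u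
inhabited u = point u , point-≻ u
  where
  point : List Bool → Cantor
  point []      i = false
  point (b ∷ u) i with i ℕ.≟ length u
  ... | yes _ = b
  ... | no _  = point u i
  point-at : ∀ b u → point (b ∷ u) (length u) ≡ b
  point-at b u with length u ℕ.≟ length u
  ... | yes _ = refl
  ... | no ≢  = contradiction refl ≢
  point-below : ∀ b u i → i ℕ.< length u → point (b ∷ u) i ≡ point u i
  point-below b u i i<n with i ℕ.≟ length u
  ... | yes refl = contradiction i<n (ℕ.<-irrefl refl)
  ... | no _     = refl
  point-≻ : ∀ u → point u ≻ u
  point-≻ []      = refl
  point-≻ (b ∷ u) = cong₂ _∷_ (point-at b u)
    (trans (Agree⇒⇂ (length u) (point-below b u)) (point-≻ u))

data Label : Set where
  always : Bool → Label
  bit    : ℕ → Label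

read : Label → Cantor → Bool
read (always b) x = b
read (bit i)    x = x i

module Trees (em : ExcludedMiddle 0ℓ) (X : Subset)
  (X-respects : ∀ {x y} → (∀ i → x i ≡ y i) → X x → X y) (φ : List Bool → ℕ) where

  Meets : List Bool → Set
  Meets u = ∃[ y ] (y ≻ u × X y)

  Leaves : List Bool → Set
  Leaves u = ∃[ z ] (z ≻ u × ¬ X z)

  Mixed : List Bool → Set
  Mixed u = Meets u × Leaves u

  inside : ∀ {u} → Mixed u → Cantor
  inside m = proj₁ (proj₁ m)

  outside : ∀ {u} → Mixed u → Cantor
  outside m = proj₁ (proj₂ m)

  -- A tree reads the bits of a point y, false leading to the first subtree.  Its
  -- leaves carry the image of y under the reduction of Φ(B) to X; the labels
  -- guide the reduction of X to Φ(B).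
  data Tree : Set where
    leaf : Cantor → Tree
    node : Label → Tree → Tree → Tree
    root : ∀ u → Mixed u → Tree

  -- Only j bits `true` in a row lead to `T`. The point `y` is always taken from X, so all but 2⁻ j
  -- of the cylinder is accepted at once.
  delay : ℕ → Cantor → Tree → Tree
  delay zero    y T = T
  delay (suc j) y T = node (always true) (leaf y) (delay j y T)

  -- The delay keeps what is not accepted below fork u of relative measure at most
  -- 2⁻ length u, whatever becomes of the child that a given branch does not take.
  enter : ∀ u → Mixed u → Bool → Tree
  enter u m b with em {Meets (b ∷ u)}
  -- X misses this child, so the accepted leaves of the delay borrow a point of X from the other
  -- half of N_u.
  ... | no _  = delay (length u) (inside m) (leaf (proj₁ (inhabited (b ∷ u))))
  ... | yes p with em {Leaves (b ∷ u)}
  ...   | no _  = leaf (proj₁ p)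
  ...   | yes q = delay (length u) (proj₁ p) (root (b ∷ u) (p , q))

  fork : ∀ u → Mixed u → Tree
  fork u m = node (bit (length u)) (enter u m false) (enter u m true)

  miss : ∀ u → Mixed u → Tree
  miss u m = delay (φ u) (inside m) (leaf (outside m))

  label : Tree → Label
  label (leaf _)     = always false
  label (node l _ _) = l
  -- At a root `false` selects the fork, so the reduction of X to Φ(B) stays out of the removed
  -- piece.
  label (root _ _)   = always false

  step : Tree → Bool → Tree
  step (leaf z)     _     = leaf z
  step (node _ s t) b     = if b then t else s
  step (root u m)   false = fork u m
  step (root u m)   true  = miss u m

  run : Tree → Cantor → ℕ → Tree
  run T y zero    = T
  run T y (suc n) = step (run T y n) (y n)

  run-+ : ∀ T y m n → run T y (n ℕ.+ m) ≡ run (run T y m) (drop m y) n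
  run-+ T y m zero    = refl
  run-+ T y m (suc n) = cong₂ step (run-+ T y m n) (cong y (ℕ.+-comm n m))

  run-Agree : ∀ T {y y′} n → Agree n y y′ → run T y n ≡ run T y′ n
  run-Agree T zero    _  = refl
  run-Agree T (suc n) ag = cong₂ step (run-Agree T n (λ i i<n → ag i (ℕ.m≤n⇒m≤1+n i<n))) (ag n ℕ.≤-refl)

  run-leaf : ∀ z y n → run (leaf z) y n ≡ leaf z
  run-leaf z y zero    = refl
  run-leaf z y (suc n) = cong (λ T → step T (y n)) (run-leaf z y n)

  leaf-injective : ∀ {z z′} → leaf z ≡ leaf z′ → z ≡ z′
  leaf-injective refl = refl

  leaf-persists : ∀ T y {z m n} → m ℕ.≤ n → run T y m ≡ leaf z → run T y n ≡ leaf z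
  leaf-persists T y {z} m≤n eq = go (ℕ.≤⇒≤′ m≤n)
    where
    go : ∀ {n} → _ ℕ.≤′ n → run T y n ≡ leaf z
    go (ℕ.≤′-reflexive refl)    = eq
    go (ℕ.≤′-step {n = n} m≤n) = cong (λ T → step T (y n)) (go m≤n)

  leaf-unique : ∀ T y {z z′} m n → run T y m ≡ leaf z → run T y n ≡ leaf z′ → z ≡ z′
  leaf-unique T y m n eq eq′ = leaf-injective (trans
    (sym (leaf-persists T y (ℕ.m≤m⊔n m n) eq)) (leaf-persists T y (ℕ.m≤n⊔m m n) eq′))

  ReachesLeaf : Tree → Cantor → Set
  ReachesLeaf T y = ∃[ n ] ∃[ z ] run T y n ≡ leaf z

  Acc : Tree → Subset
  Acc T y = ∃[ n ] ∃[ z ] (run T y n ≡ leaf z × X z)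

  Dis : Tree → Subset
  Dis T y = ∃[ n ] ∃[ z ] (run T y n ≡ leaf z × ¬ X z)

  Acc-Dis-disjoint : ∀ T y → Acc T y → ¬ Dis T y
  Acc-Dis-disjoint T y (m , z , eq , z∈X) (n , z′ , eq′ , z′∉X) =
    z′∉X (subst X (leaf-unique T y m n eq eq′) z∈X)

  ReachesLeaf-step : ∀ T y → ReachesLeaf (step T (y 0)) (tail y) → ReachesLeaf T y
  ReachesLeaf-step T y (n , z , eq) = n ℕ.+ 1 , z , trans (run-+ T y 1 n) eq

  Doomed : Tree → Set
  Doomed T = ∀ y → ReachesLeaf T y

  Doomed-leaf : ∀ z → Doomed (leaf z)
  Doomed-leaf z y = 0 , z , refl

  Doomed-node : ∀ l {s t} → Doomed s → Doomed t → Doomed (node l s t)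
  Doomed-node l {s} {t} ds dt y = ReachesLeaf-step (node l s t) y (pick (y 0))
    where
    pick : ∀ b → ReachesLeaf (if b then t else s) (tail y)
    pick false = ds (tail y)
    pick true  = dt (tail y)

  Doomed-delay : ∀ j y {T} → Doomed T → Doomed (delay j y T)
  Doomed-delay zero    y d = d
  Doomed-delay (suc j) y d = Doomed-node (always true) (Doomed-leaf y) (Doomed-delay j y d)

  Doomed-miss : ∀ u m → Doomed (miss u m)
  Doomed-miss u m = Doomed-delay (φ u) (inside m) (Doomed-leaf (outside m))

  -- The invariant behind the continuity of `g`: all values still possible below the tree lie in one
  -- cylinder. At a root it says that `v` extends `u`.
  Ext : List Bool → Tree → Set
  Ext u (leaf z)     = z ≻ u
  Ext u (node _ s t) = Ext u s × Ext u t
  Ext u (root v _)   = ∀ z → z ≻ v → z ≻ u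

  Ext-delay : ∀ {u} j {y T} → y ≻ u → Ext u T → Ext u (delay j y T)
  Ext-delay zero    y≻u e = e
  Ext-delay (suc j) y≻u e = y≻u , Ext-delay j y≻u e

  Ext-enter : ∀ {u} v m b → Ext u (root v m) → Ext u (enter v m b)
  Ext-enter v m b e with em {Meets (b ∷ v)}
  ... | no _  = Ext-delay (length v) (e (inside m) (proj₁ (proj₂ (proj₁ m)))) (e z (proj₂ (≻-∷⁻ z b v (proj₂ (inhabited (b ∷ v))))))
    where z = proj₁ (inhabited (b ∷ v))
  ... | yes p with em {Leaves (b ∷ v)}
  ...   | no _  = e (proj₁ p) (proj₂ (≻-∷⁻ (proj₁ p) b v (proj₁ (proj₂ p))))
  ...   | yes q = Ext-delay (length v) (e (proj₁ p) (proj₂ (≻-∷⁻ (proj₁ p) b v (proj₁ (proj₂ p)))))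
                    (λ z z≻ → e z (proj₂ (≻-∷⁻ z b v z≻)))

  Ext-step : ∀ {u} T b → Ext u T → Ext u (step T b)
  Ext-step (leaf z)     b     e         = e
  Ext-step (node _ s t) false (es , et) = es
  Ext-step (node _ s t) true  (es , et) = et
  Ext-step (root v m)   false e         = Ext-enter v m false e , Ext-enter v m true e
  Ext-step (root v m)   true  e         = Ext-delay (φ v) (e (inside m) (proj₁ (proj₂ (proj₁ m)))) (e (outside m) (proj₁ (proj₂ (proj₂ m))))

  Ext-run : ∀ {u} T y n → Ext u T → Ext u (run T y n)
  Ext-run T y zero    e = e
  Ext-run T y (suc n) e = Ext-step (run T y n) (y n) (Ext-run T y n e)

  Ext-later : ∀ {u} T y {m n} → m ℕ.≤ n → Ext u (run T y m) → Ext u (run T y n)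
  Ext-later {u} T y {m} {n} m≤n e = subst (Ext u)
    (trans (sym (run-+ T y m (n ℕ.∸ m))) (cong (run T y) (ℕ.m∸n+n≡m m≤n)))
    (Ext-run (run T y m) (drop m y) (n ℕ.∸ m) e)

  -- The positions of a branch of K from the delay before root `u` to the fork after it. The deficit
  -- has to be controlled at each of them, not only at the roots.
  data Stage (u : List Bool) : Tree → Set where
    waiting : ∀ j m → Stage u (delay j (inside m) (root u m))
    forking : ∀ m → Stage u (fork u m)

  Stage-Ext : ∀ {u T} → Stage u T → Ext u T
  Stage-Ext {u} (waiting j m) = Ext-delay j (proj₁ (proj₂ (proj₁ m))) (λ _ z≻u → z≻u)
  Stage-Ext {u} (forking m)   = Ext-step (root u m) false (λ _ z≻u → z≻u)

  Stage-enter : ∀ u m b → Stage (b ∷ u) (enter u m b) ⊎ Doomed (enter u m b)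
  Stage-enter u m b with em {Meets (b ∷ u)}
  ... | no _  = inj₂ (Doomed-delay (length u) _ (Doomed-leaf _))
  ... | yes p with em {Leaves (b ∷ u)}
  ...   | no _  = inj₂ (Doomed-leaf _)
  ...   | yes q = inj₁ (waiting (length u) (p , q))

  Stage-step : ∀ {u T} b → Stage u T →
    (∃[ v ] (length u ℕ.≤ length v × Stage v (step T b))) ⊎ Doomed (step T b)
  Stage-step {u} false (waiting zero m)    = inj₁ (u , ℕ.≤-refl , forking m)
  Stage-step {u} true  (waiting zero m)    = inj₂ (Doomed-miss u m)
  Stage-step {u} false (waiting (suc j) m) = inj₂ (Doomed-leaf _)
  Stage-step {u} true  (waiting (suc j) m) = inj₁ (u , ℕ.≤-refl , waiting j m)
  Stage-step {u} false (forking m) with Stage-enter u m false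
  ... | inj₁ s = inj₁ (false ∷ u , ℕ.n≤1+n _ , s)
  ... | inj₂ d = inj₂ d
  Stage-step {u} true  (forking m) with Stage-enter u m true
  ... | inj₁ s = inj₁ (true ∷ u , ℕ.n≤1+n _ , s)
  ... | inj₂ d = inj₂ d

  -- Following the labels for x leads to x itself or to a point with the same
  -- status with respect to X.
  Comp : Cantor → Tree → Set
  Comp x (leaf z)     = (X z → X x) × (X x → X z)
  Comp x (node l s t) = if read l x then Comp x t else Comp x s
  Comp x (root u _)   = x ≻ u

  Comp-delay : ∀ {x} j y {T} → Comp x T → Comp x (delay j y T)
  Comp-delay zero    y c = c
  Comp-delay (suc j) y c = Comp-delay j y c

  Comp-enter : ∀ {x} u m b → x ≻ (b ∷ u) → Comp x (enter u m b)
  Comp-enter {x} u m b x≻ with em {Meets (b ∷ u)}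
  ... | no ¬p = Comp-delay (length u) (inside m)
                  ((λ z∈X → contradiction (_ , proj₂ (inhabited (b ∷ u)) , z∈X) ¬p) ,
                   (λ x∈X → contradiction (x , x≻ , x∈X) ¬p))
  ... | yes p with em {Leaves (b ∷ u)}
  ...   | no ¬q = (λ _ → x∈X) , (λ _ → proj₂ (proj₂ p))
    where
    x∈X : X x
    x∈X with em {X x}
    ... | yes x∈ = x∈
    ... | no x∉  = contradiction (x , x≻ , x∉) ¬q
  ...   | yes q = Comp-delay (length u) (proj₁ p) x≻

  Comp-step : ∀ {x} T → Comp x T → Comp x (step T (read (label T) x))
  Comp-step (leaf z) c = c
  Comp-step {x} (node l s t) c with read l x
  ... | false = c
  ... | true  = c
  Comp-step {x} (root u m) x≻u with x (length u) in eq
  ... | false = Comp-enter u m false (cong₂ _∷_ eq x≻u)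
  ... | true  = Comp-enter u m true (cong₂ _∷_ eq x≻u)

  -- The two continuous maps

  module From (T₀ : Tree) (ℓ₀ : ℕ)
    (start : ∀ y → ¬ ReachesLeaf T₀ y → ∃[ m ] run T₀ y ℓ₀ ≡ root [] m)
    (Comp-start : ∀ x → Comp x T₀) where

    -- From one root to the next, one bit selects the fork, one bit chooses the child, and the delay
    -- at depth k takes k more.
    time : ℕ → ℕ
    time zero    = ℓ₀
    time (suc k) = k ℕ.+ suc (suc (time k))

    n≤time : ∀ n → n ℕ.≤ time n
    n≤time zero    = ℕ.z≤n
    n≤time (suc n) = ℕ.≤-trans (ℕ.s≤s (n≤time n)) (ℕ.≤-trans (ℕ.n≤1+n _) (ℕ.m≤n+m _ n))

    -- root x↾k is reached after time k bits; one bit later the fork reads x k.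
    limit : Cantor → Cantor
    limit y k = y (suc (time k))

    leaf⇒reaches : ∀ y n → Doomed (run T₀ y n) → ReachesLeaf T₀ y
    leaf⇒reaches y n d with d (drop n y)
    ... | k , z , eq = k ℕ.+ n , z , trans (run-+ T₀ y n k) eq

    delay-run : ∀ {y} → ¬ ReachesLeaf T₀ y → ∀ j {w T} n → run T₀ y n ≡ delay j w T → run T₀ y (j ℕ.+ n) ≡ T
    delay-run         live zero    n eq = eq
    delay-run {y} live (suc j) {w} {T} n eq = subst (λ k → run T₀ y k ≡ T) (ℕ.+-suc j n)
      (delay-run live j (suc n) (advance (y n) refl))
      where
      advance : ∀ b → y n ≡ b → run T₀ y (suc n) ≡ delay j w T
      advance true  yn = cong₂ step eq yn
      advance false yn = contradiction (suc n , w , cong₂ step eq yn) live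

    at-root : ∀ {y} → ¬ ReachesLeaf T₀ y → ∀ k → ∃[ m ] run T₀ y (time k) ≡ root (limit y ⇂ k) m
    at-root {y} live zero = start y live
    at-root {y} live (suc k) with at-root live k
    ... | m , eq = subst (λ j → ∃[ m ] run T₀ y (j ℕ.+ suc (suc (time k))) ≡ root (limit y ⇂ suc k) m)
                     (length-⇂ (limit y) k) arrive
      where
      u = limit y ⇂ k
      at-fork : ∀ b → y (time k) ≡ b → run T₀ y (suc (time k)) ≡ fork u m
      at-fork false y≡ = cong₂ step eq y≡
      at-fork true  y≡ = contradiction (leaf⇒reaches y (suc (time k))
        (subst Doomed (sym (cong₂ step eq y≡)) (Doomed-miss u m))) live
      after-fork : ∀ b → y (suc (time k)) ≡ b → run T₀ y (suc (suc (time k))) ≡ enter u m b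
      after-fork false y≡ = cong₂ step (at-fork _ refl) y≡
      after-fork true  y≡ = cong₂ step (at-fork _ refl) y≡
      leave : ∀ b → run T₀ y (suc (suc (time k))) ≡ enter u m b →
        ∃[ m ] run T₀ y (length u ℕ.+ suc (suc (time k))) ≡ root (b ∷ u) m
      leave b at with em {Meets (b ∷ u)}
      ... | no _  = contradiction (leaf⇒reaches y (suc (suc (time k))) (subst Doomed (sym at) (Doomed-delay (length u) _ (Doomed-leaf _)))) live
      ... | yes p with em {Leaves (b ∷ u)}
      ...   | no _  = contradiction (leaf⇒reaches y (suc (suc (time k))) (subst Doomed (sym at) (Doomed-leaf _))) live
      ...   | yes q = (p , q) , delay-run live (length u) _ at
      arrive : ∃[ m ] run T₀ y (length u ℕ.+ suc (suc (time k))) ≡ root (limit y ⇂ suc k) m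
      arrive = leave _ (after-fork _ refl)

    Stage-after : ∀ {y} → ¬ ReachesLeaf T₀ y → ∀ k n → time k ℕ.≤ n →
      ∃[ u ] (k ℕ.≤ length u × Stage u (run T₀ y n))
    Stage-after {y} live k n t≤n = go (ℕ.≤⇒≤′ t≤n)
      where
      go : ∀ {n} → time k ℕ.≤′ n → ∃[ u ] (k ℕ.≤ length u × Stage u (run T₀ y n))
      go (ℕ.≤′-reflexive refl) with at-root live k
      ... | m , eq = limit y ⇂ k , ℕ.≤-reflexive (sym (length-⇂ (limit y) k)) , subst (Stage (limit y ⇂ k)) (sym eq) (waiting 0 m)
      go (ℕ.≤′-step {n = n} t≤n) with go t≤n
      ... | u , k≤ , s with Stage-step (y n) s
      ...   | inj₁ (v , u≤v , s′) = v , ℕ.≤-trans k≤ u≤v , s′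
      ...   | inj₂ d = contradiction (leaf⇒reaches y (suc n) d) live

    -- The invariant persists from n to `time n`, where the branch stands at the root for
    -- `limit y ⇂ n`; there it speaks of every point extending that sequence, in particular of the
    -- limit.
    limit-≻ : ∀ {y} → ¬ ReachesLeaf T₀ y → ∀ n {u} → Ext u (run T₀ y n) → limit y ≻ u
    limit-≻ {y} live n {u} e with at-root live n
    ... | m , eq = subst (Ext u) eq (Ext-later T₀ y (n≤time n) e)
                     (limit y) (≻-⇂ {limit y} {limit y} {n} refl)

    g : Cantor → Cantor
    g y with em {ReachesLeaf T₀ y}
    ... | yes (_ , z , _) = z
    ... | no _            = limit y

    g-leaf : ∀ y n {z} → run T₀ y n ≡ leaf z → g y ≡ z
    g-leaf y n eq with em {ReachesLeaf T₀ y}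
    ... | yes (n′ , z′ , eq′) = leaf-unique T₀ y n′ n eq′ eq
    ... | no live             = contradiction (n , _ , eq) live

    g-limit : ∀ {y} → ¬ ReachesLeaf T₀ y → g y ≡ limit y
    g-limit {y} live with em {ReachesLeaf T₀ y}
    ... | yes reaches = contradiction reaches live
    ... | no _        = refl

    g-≻ : ∀ y n {u} → Ext u (run T₀ y n) → g y ≻ u
    g-≻ y n {u} e with em {ReachesLeaf T₀ y}
    ... | no live          = limit-≻ live n e
    ... | yes (k , z , eq) = subst (Ext u) (leaf-persists T₀ y (ℕ.m≤m⊔n k n) eq) (Ext-later T₀ y (ℕ.m≤n⊔m k n) e)

    -- Near a point that reaches a leaf `g` is constant. Near a branch of K the root at `time k`
    -- confines all values to one cylinder of depth k.
    g-continuous : Continuous g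
    g-continuous y k with em {ReachesLeaf T₀ y}
    ... | yes (n , z , eq) = n , λ y′ same → cong (_↾ k)
            (sym (g-leaf y′ n (trans (sym (run-Agree T₀ n (↾⇒Agree n same))) eq)))
    ... | no live with at-root live k
    ...   | m , eq = time k , λ y′ same → Agree⇒↾ k (⇂⇒Agree k (sym (trans
              (cong (g y′ ⇂_) (sym (length-⇂ (limit y) k)))
              (g-≻ y′ (time k) (subst (Ext (limit y ⇂ k)) (trans (sym eq) (run-Agree T₀ (time k) (↾⇒Agree (time k) same))) (λ _ z≻ → z≻))))))

    navigate : Cantor → ℕ → Tree
    navigate x zero    = T₀
    navigate x (suc n) = step (navigate x n) (read (label (navigate x n)) x)

    h : Cantor → Cantor
    h x n = read (label (navigate x n)) x

    run-h : ∀ x n → run T₀ (h x) n ≡ navigate x n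
    run-h x zero    = refl
    run-h x (suc n) = cong (λ T → step T (h x n)) (run-h x n)

    modulus : Label → ℕ
    modulus (always _) = 0
    modulus (bit i)    = suc i

    read-Agree : ∀ l {x y} → Agree (modulus l) x y → read l x ≡ read l y
    read-Agree (always b) _  = refl
    read-Agree (bit i)    ag = ag i ℕ.≤-refl

    h-modulus : Cantor → ℕ → ℕ
    h-modulus x zero    = 0
    h-modulus x (suc n) = h-modulus x n ℕ.⊔ modulus (label (navigate x n))

    Agree-≤ : ∀ {m n x y} → m ℕ.≤ n → Agree n x y → Agree m x y
    Agree-≤ m≤n ag i i<m = ag i (ℕ.<-≤-trans i<m m≤n)

    navigate-Agree : ∀ x y n → Agree (h-modulus x n) x y → navigate x n ≡ navigate y n × Agree n (h x) (h y)
    navigate-Agree x y zero    ag = refl , λ _ ()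
    navigate-Agree x y (suc n) ag = cong₂ step same read-same , agree
      where
      ih : navigate x n ≡ navigate y n × Agree n (h x) (h y)
      ih = navigate-Agree x y n (Agree-≤ (ℕ.m≤m⊔n _ _) ag)
      same : navigate x n ≡ navigate y n
      same = proj₁ ih
      read-same : h x n ≡ h y n
      read-same = trans (read-Agree (label (navigate x n)) (Agree-≤ (ℕ.m≤n⊔m (h-modulus x n) _) ag))
                    (cong (λ T → read (label T) y) same)
      agree : Agree (suc n) (h x) (h y)
      agree i i<1+n with ℕ.m<1+n⇒m<n∨m≡n i<1+n
      ... | inj₁ i<n  = proj₂ ih i i<n
      ... | inj₂ refl = read-same

    h-continuous : Continuous h
    h-continuous x n = h-modulus x n , λ y same →
      Agree⇒↾ n (proj₂ (navigate-Agree x y n (↾⇒Agree (h-modulus x n) same)))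

    Comp-navigate : ∀ x n → Comp x (navigate x n)
    Comp-navigate x zero    = Comp-start x
    Comp-navigate x (suc n) = Comp-step (navigate x n) (Comp-navigate x n)

    -- `Comp` survives every step along the labels. If a leaf is reached, its point has the same
    -- status as x; otherwise the forks have read every bit of x.
    g∘h : ∀ x → (X (g (h x)) → X x) × (X x → X (g (h x)))
    g∘h x with em {ReachesLeaf T₀ (h x)}
    ... | yes (n , z , eq) = subst (Comp x) (trans (sym (run-h x n)) eq) (Comp-navigate x n)
    ... | no live = X-respects (λ i → sym (x≗ i)) , X-respects x≗
      where
      x≗ : ∀ i → x i ≡ limit (h x) i
      x≗ i with at-root live (suc i)
      ... | m , eq = ⇂⇒Agree (suc i)
        (trans (cong (x ⇂_) (sym (length-⇂ (limit (h x)) (suc i))))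
          (subst (Comp x) (trans (sym (run-h x (time (suc i)))) eq) (Comp-navigate x (time (suc i)))))
        i ℕ.≤-refl

-- Measures of the sets decided by a tree

average-≤ : ∀ {a b c} → a ≤ c → b ≤ c → ½ * a + ½ * b ≤ c
average-≤ {a} {b} {c} a≤c b≤c = ≤-trans
  (+-mono-≤ (*-monoʳ-≤ ½ 0≤½ a≤c) (*-monoʳ-≤ ½ 0≤½ b≤c))
  (≤-reflexive (solve 1 (λ c → con ½ :* c :+ con ½ :* c := c) refl c))

*-≤1 : ∀ {a b} → 0ℚ ≤ a → b ≤ 1ℚ → a * b ≤ a
*-≤1 {a} {b} 0≤a b≤1 = subst (a * b ≤_) (*-identityʳ a) (*-monoʳ-≤ a 0≤a b≤1)

module Measures (em : ExcludedMiddle 0ℓ) (X : Subset)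
  (X-respects : ∀ {x y} → (∀ i → x i ≡ y i) → X x → X y) (φ : List Bool → ℕ)
  (φ≤length : ∀ u → φ u ℕ.≤ length u) where

  open Trees em X X-respects φ

  Acc-step⁺ : ∀ T y → Acc (step T (y 0)) (tail y) → Acc T y
  Acc-step⁺ T y (n , z , eq , z∈X) = n ℕ.+ 1 , z , trans (run-+ T y 1 n) eq , z∈X

  Acc-step⁻ : ∀ T y → Acc T y → Acc (step T (y 0)) (tail y)
  Acc-step⁻ T y (n , z , eq , z∈X) = n , z ,
    trans (sym (run-+ T y 1 n)) (leaf-persists T y (ℕ.m≤m+n n 1) eq) , z∈X

  Rej : Tree → Subset
  Rej T y = ¬ Acc T y

  Cov-Rej-step : ∀ T {a b} → Cov (Rej (step T false)) a → Cov (Rej (step T true)) b → Cov (Rej T) (½ * a + ½ * b)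
  Cov-Rej-step T cov₀ cov₁ = Cov-join (Cov-mono (restrict false) ≤-refl cov₀) (Cov-mono (restrict true) ≤-refl cov₁)
    where
    restrict : ∀ b y → Tail b (Rej T) y → Rej (step T b) y
    restrict b y (x , rej , refl , refl) acc = rej (Acc-step⁺ T x acc)

  module _ (λᵥ : Cantor → ℚ) (ρ : List Bool → ℚ) where

    -- The expected value at the end of a random run, where λᵥ z is paid at the
    -- leaf z and ρ u at root u, and the run stops at the first root.
    value : Tree → ℚ
    value (leaf z)     = λᵥ z
    value (node _ s t) = ½ * value s + ½ * value t
    value (root u _)   = ρ u

    value-delay : ∀ j {y} T → λᵥ y ≡ 0ℚ → value (delay j y T) ≡ 2⁻ j * value T
    value-delay zero    T λy≡0 = sym (*-identityˡ (value T))
    value-delay (suc j) T λy≡0 = trans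
      (cong₂ (λ a b → ½ * a + ½ * b) λy≡0 (value-delay j T λy≡0))
      (solve 2 (λ p v → con ½ :* con 0ℚ :+ con ½ :* (p :* v) := con ½ :* p :* v) refl (2⁻ j) (value T))

  loss : Cantor → ℚ
  loss z with em {X z}
  ... | yes _ = 0ℚ
  ... | no _  = 1ℚ

  loss-∈ : ∀ {z} → X z → loss z ≡ 0ℚ
  loss-∈ {z} z∈X with em {X z}
  ... | yes _   = refl
  ... | no z∉X = contradiction z∈X z∉X

  loss≤1 : ∀ z → loss z ≤ 1ℚ
  loss≤1 z with em {X z}
  ... | yes _ = <⇒≤ 0<1
  ... | no _  = ≤-refl

  Cov-Rej-leaf : ∀ z → Cov (Rej (leaf z)) (loss z)
  Cov-Rej-leaf z with em {X z}
  ... | yes z∈X = Cov-∅ (λ y rej → rej (0 , z , refl , z∈X))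
  ... | no _    = Cov-U

  Cov-Rej : ∀ ρ → (∀ u m → Cov (Rej (root u m)) (ρ u)) → ∀ T → Cov (Rej T) (value loss ρ T)
  Cov-Rej ρ roots (leaf z)     = Cov-Rej-leaf z
  Cov-Rej ρ roots (node l s t) = Cov-Rej-step (node l s t) (Cov-Rej ρ roots s) (Cov-Rej ρ roots t)
  Cov-Rej ρ roots (root u m)   = roots u m

  inside-loss : ∀ {u} (m : Mixed u) → loss (inside m) ≡ 0ℚ
  inside-loss m = loss-∈ (proj₂ (proj₂ (proj₁ m)))

  module _ (ρ : List Bool → ℚ) (ρ≤1 : ∀ u → ρ u ≤ 1ℚ) where

    value-delay-≤ : ∀ j {y} T → loss y ≡ 0ℚ → value loss ρ T ≤ 1ℚ → value loss ρ (delay j y T) ≤ 2⁻ j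
    value-delay-≤ j {y} T loss≡0 v≤1 = subst (_≤ 2⁻ j) (sym (value-delay loss ρ j T loss≡0)) (*-≤1 (<⇒≤ (2⁻-positive j)) v≤1)

    value-enter : ∀ u m b → value loss ρ (enter u m b) ≤ 2⁻ length u
    value-enter u m b with em {Meets (b ∷ u)}
    ... | no _  = value-delay-≤ (length u) (leaf _) (inside-loss m) (loss≤1 _)
    ... | yes p with em {Leaves (b ∷ u)}
    ...   | no _  = subst (_≤ 2⁻ length u) (sym (loss-∈ (proj₂ (proj₂ p)))) (<⇒≤ (2⁻-positive (length u)))
    ...   | yes q = value-delay-≤ (length u) (root (b ∷ u) (p , q)) (loss-∈ (proj₂ (proj₂ p))) (ρ≤1 (b ∷ u))

    value-fork : ∀ u m → value loss ρ (fork u m) ≤ 2⁻ φ u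
    value-fork u m = ≤-trans (average-≤ (value-enter u m false) (value-enter u m true))
      (2⁻-antitone {φ u} {length u} (φ≤length u))

  -- A bootstrap: the trivial bound 1 at the next roots is enough, since the delays shrink it to 2⁻
  -- length u, and `miss` contributes at most 2⁻ φ u.
  Cov-Rej-root : ∀ u m → Cov (Rej (root u m)) (2⁻ φ u)
  Cov-Rej-root u m = Cov-mono (λ _ rej → rej)
    (average-≤ (value-fork one (λ _ → ≤-refl) u m)
               (value-delay-≤ one (λ _ → ≤-refl) (φ u) (leaf (outside m)) (inside-loss m) (loss≤1 (outside m))))
    (Cov-Rej-step (root u m) (Cov-Rej one roots (fork u m)) (Cov-Rej one roots (miss u m)))
    where
    one : List Bool → ℚ
    one _ = 1ℚ
    roots : ∀ u m → Cov (Rej (root u m)) (one u)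
    roots _ _ = Cov-U

  ρφ : List Bool → ℚ
  ρφ u = 2⁻ φ u

  deficit : Tree → ℚ
  deficit = value loss ρφ

  Cov-deficit : ∀ T → Cov (Rej T) (deficit T)
  Cov-deficit = Cov-Rej ρφ Cov-Rej-root

  deficit-Stage : ∀ {u T} → Stage u T → deficit T ≤ 2⁻ φ u
  deficit-Stage {u} (waiting j m) = subst (_≤ 2⁻ φ u)
    (trans (*-comm (2⁻ φ u) (2⁻ j)) (sym (value-delay loss ρφ j (root u m) (inside-loss m))))
    (*-≤1 (<⇒≤ (2⁻-positive (φ u))) (2⁻≤1 j))
  deficit-Stage {u} (forking m)   = value-fork ρφ (λ u → 2⁻≤1 (φ u)) u m

  -- Carathéodory's criterion up to an error `ε`, the allowance for the part of the space that is
  -- not yet decided; `η` absorbs the rational splitting of covers.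
  Splits : Tree → ℚ → Set₁
  Splits T ε = ∀ (E : Subset) r → Cov E r → ∀ {η} → 0ℚ < η →
    ∃[ a ] ∃[ b ] (a + b ≤ r + ε + η × Cov (E ∩ Acc T) a × Cov (E ∖ Acc T) b)

  Splits-mono : ∀ {T ε ε′} → ε ≤ ε′ → Splits T ε → Splits T ε′
  Splits-mono {T} {ε} {ε′} ε≤ε′ splits E r cov {η} 0<η = relax (splits E r cov 0<η)
    where
    relax : ∃[ a ] ∃[ b ] (a + b ≤ r + ε + η × Cov (E ∩ Acc T) a × Cov (E ∖ Acc T) b) →
            ∃[ a ] ∃[ b ] (a + b ≤ r + ε′ + η × Cov (E ∩ Acc T) a × Cov (E ∖ Acc T) b)
    relax (a , b , ≤₁ , c₁ , c₂) = a , b , ≤-trans ≤₁ (+-monoˡ-≤ η (+-monoʳ-≤ r ε≤ε′)) , c₁ , c₂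

  Splits-one : ∀ T → Splits T 1ℚ
  Splits-one T E r cov 0<η = r , 1ℚ , p≤p+q (<⇒≤ 0<η) , Cov-mono (λ _ → proj₁) ≤-refl cov , Cov-U

  Splits-leaf : ∀ z → Splits (leaf z) 0ℚ
  Splits-leaf z E r cov {η} 0<η = by-membership (em {X z})
    where
    sum : ∀ {s} → s ≡ r → s ≤ r + 0ℚ + η
    sum refl = ≤-trans (p≤p+q ≤-refl) (p≤p+q (<⇒≤ 0<η))
    by-membership : Dec (X z) → ∃[ a ] ∃[ b ] (a + b ≤ r + 0ℚ + η × Cov (E ∩ Acc (leaf z)) a × Cov (E ∖ Acc (leaf z)) b)
    by-membership (yes z∈X) = r , 0ℚ , sum (+-identityʳ r) , Cov-mono (λ _ → proj₁) ≤-refl cov ,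
      Cov-∅ (λ { y (_ , rej) → rej (0 , z , refl , z∈X) })
    by-membership (no z∉X)  = 0ℚ , r , sum (+-identityˡ r) ,
      Cov-∅ (λ { y (_ , acc) → Acc-Dis-disjoint (leaf z) y acc (0 , z , refl , z∉X) }) ,
      Cov-mono (λ _ → proj₁) ≤-refl cov

  Splits-step : ∀ T {ε₀ ε₁} → Splits (step T false) ε₀ → Splits (step T true) ε₁ → Splits T (½ * ε₀ + ½ * ε₁)
  Splits-step T {ε₀} {ε₁} splits₀ splits₁ E r cov {η} 0<η = halves (Cov-halve em cov 0<η)
    where
    Goal : Set
    Goal = ∃[ a ] ∃[ b ] (a + b ≤ r + (½ * ε₀ + ½ * ε₁) + η × Cov (E ∩ Acc T) a × Cov (E ∖ Acc T) b)
    on-Acc : ∀ b y → Tail b (E ∩ Acc T) y → (Tail b E ∩ Acc (step T b)) y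
    on-Acc b y (x , (x∈E , acc) , refl , refl) = (x , x∈E , refl , refl) , Acc-step⁻ T x acc
    off-Acc : ∀ b y → Tail b (E ∖ Acc T) y → (Tail b E ∖ Acc (step T b)) y
    off-Acc b y (x , (x∈E , rej) , refl , refl) = (x , x∈E , refl , refl) , λ acc → rej (Acc-step⁺ T x acc)
    combine : ∀ {e₀ e₁} → e₀ + e₁ ≤ r + r + η →
      ∃[ a ] ∃[ b ] (a + b ≤ e₀ + ε₀ + ½ * η × Cov (Tail false E ∩ Acc (step T false)) a × Cov (Tail false E ∖ Acc (step T false)) b) →
      ∃[ a ] ∃[ b ] (a + b ≤ e₁ + ε₁ + ½ * η × Cov (Tail true E ∩ Acc (step T true)) a × Cov (Tail true E ∖ Acc (step T true)) b) →
      Goal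
    combine {e₀} {e₁} e≤ (a₀ , b₀ , ≤₀ , A₀ , B₀) (a₁ , b₁ , ≤₁ , A₁ , B₁) =
      ½ * a₀ + ½ * a₁ , ½ * b₀ + ½ * b₁ ,
      ≤-from (*-monoʳ-≤ ½ 0≤½ (+-mono-≤ e≤ (+-mono-≤ ≤₀ ≤₁)))
        (solve 10 (λ a₀ a₁ b₀ b₁ r η e₀ e₁ p₀ p₁ →
           con ½ :* a₀ :+ con ½ :* a₁ :+ (con ½ :* b₀ :+ con ½ :* b₁) :+
             con ½ :* (r :+ r :+ η :+ (e₀ :+ p₀ :+ con ½ :* η :+ (e₁ :+ p₁ :+ con ½ :* η))) :=
           r :+ (con ½ :* p₀ :+ con ½ :* p₁) :+ η :+ con ½ :* (e₀ :+ e₁ :+ (a₀ :+ b₀ :+ (a₁ :+ b₁)))) refl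
           a₀ a₁ b₀ b₁ r η e₀ e₁ ε₀ ε₁) ,
      Cov-join (Cov-mono (on-Acc false) ≤-refl A₀) (Cov-mono (on-Acc true) ≤-refl A₁) ,
      Cov-join (Cov-mono (off-Acc false) ≤-refl B₀) (Cov-mono (off-Acc true) ≤-refl B₁)
    halves : ∃[ e₀ ] ∃[ e₁ ] (e₀ + e₁ ≤ r + r + η × Cov (Tail false E) e₀ × Cov (Tail true E) e₁) → Goal
    -- Halving the cover adds `η` at the doubled scale and the children add ½η each; averaging turns
    -- these into a total of `η`.
    halves (e₀ , e₁ , e≤ , E₀ , E₁) = combine {e₀} {e₁} e≤
      (splits₀ (Tail false E) e₀ E₀ (½-positive 0<η)) (splits₁ (Tail true E) e₁ E₁ (½-positive 0<η))

  nil : Cantor → ℚ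
  nil _ = 0ℚ

  Splits-value : ∀ ε → (∀ u m → Splits (root u m) ε) → ∀ T → Splits T (value nil (λ _ → ε) T)
  Splits-value ε roots (leaf z)     = Splits-leaf z
  Splits-value ε roots (node l s t) = Splits-step (node l s t) (Splits-value ε roots s) (Splits-value ε roots t)
  Splits-value ε roots (root u m)   = roots u m

  value-nil-≤ : ∀ {ε} → 0ℚ ≤ ε → ∀ T → value nil (λ _ → ε) T ≤ ε
  value-nil-≤ 0≤ε (leaf z)     = 0≤ε
  value-nil-≤ 0≤ε (node l s t) = average-≤ (value-nil-≤ 0≤ε s) (value-nil-≤ 0≤ε t)
  value-nil-≤ 0≤ε (root u m)   = ≤-refl

  -- The half of a root's cylinder that goes to `miss` is decided without error, so every further
  -- generation of roots halves the error. This is the nullity of K.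
  Splits-2⁻ : ∀ n T → Splits T (2⁻ n)
  Splits-2⁻ zero    T = Splits-one T
  Splits-2⁻ (suc n) T = Splits-mono (value-nil-≤ (<⇒≤ (2⁻-positive (suc n))) T)
    (Splits-value (2⁻ suc n) roots T)
    where
    below : ∀ T → Splits T (value nil (λ _ → 2⁻ n) T)
    below = Splits-value (2⁻ n) (λ u m → Splits-2⁻ n (root u m))
    roots : ∀ u m → Splits (root u m) (2⁻ suc n)
    roots u m = Splits-mono {root u m} (≤-reflexive (trans
        (cong (½ * 2⁻ n +_) (cong (½ *_) (trans (value-delay nil (λ _ → 2⁻ n) (φ u) (leaf (outside m)) refl) (*-zeroʳ (2⁻ φ u)))))
        (solve 1 (λ p → con ½ :* p :+ con ½ :* con 0ℚ := con ½ :* p) refl (2⁻ n))))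
      (Splits-step (root u m)
        (Splits-mono {fork u m} (value-nil-≤ (<⇒≤ (2⁻-positive n)) (fork u m)) (below (fork u m)))
        (below (miss u m)))

  Acc-measurable : ∀ T → Measurable (Acc T)
  Acc-measurable T E q μE<q = from-Cov (μ⇒Cov μE<q)
    where
    Goal : Set
    Goal = ∃[ r ] ∃[ s ] (r + s ≡ q × μ[ E ∩ Acc T ]< r × μ[ E ∖ Acc T ]< s)
    distribute : ∀ {a b} → a + b < q → Cov (E ∩ Acc T) a → Cov (E ∖ Acc T) b → Goal
    distribute {a} {b} a+b<q A B = a + γ , b + γ ,
      solve 3 (λ a b q → a :+ con ½ :* (q :- (a :+ b)) :+ (b :+ con ½ :* (q :- (a :+ b))) := q) refl a b q ,
      Cov⇒μ A (subst (_< a + γ) (+-identityʳ a) (+-monoʳ-< a 0<γ)) ,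
      Cov⇒μ B (subst (_< b + γ) (+-identityʳ b) (+-monoʳ-< b 0<γ))
      where
      γ = ½ * (q - (a + b))
      0<γ : 0ℚ < γ
      0<γ = ½-positive {q - (a + b)} (<-from a+b<q (solve 2 (λ q s → con 0ℚ :+ q := q :- s :+ s) refl q (a + b)))
    from-Cov : ∃[ r ] (r < q × Cov E r) → Goal
    from-Cov (r , r<q , cov) = choose (2⁻-small 0<γ)
      where
      -- Half of the margin pays for the undecided part 2⁻ n, the other half for the slack of
      -- `Splits`.
      γ = ½ * (q - r)
      0<γ : 0ℚ < γ
      0<γ = ½-positive {q - r} (<-from r<q (solve 2 (λ q r → con 0ℚ :+ q := q :- r :+ r) refl q r))
      choose : ∃[ n ] 2⁻ n < γ → Goal
      choose (n , 2⁻n<γ) = finish (Splits-2⁻ n T E r cov 0<γ)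
        where
        finish : ∃[ a ] ∃[ b ] (a + b ≤ r + 2⁻ n + γ × Cov (E ∩ Acc T) a × Cov (E ∖ Acc T) b) → Goal
        finish (a , b , a+b≤ , A , B) = distribute
          (≤-<-trans a+b≤ (<-from 2⁻n<γ
            (solve 3 (λ r p q → r :+ p :+ con ½ :* (q :- r) :+ con ½ :* (q :- r) := q :+ p) refl r (2⁻ n) q))) A B

-- Densities and reductions

module Densities (em : ExcludedMiddle 0ℓ) (X : Subset)
  (X-respects : ∀ {x y} → (∀ i → x i ≡ y i) → X x → X y) (φ : List Bool → ℕ)
  (φ≤length : ∀ u → φ u ℕ.≤ length u)
  (φ-unbounded : ∀ x → X x → ∀ M → ∃[ k₀ ] (∀ k → k₀ ℕ.≤ k → M ℕ.≤ φ (x ⇂ k)))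
  (φ-bounded : ∀ x → ¬ X x → ∃[ M ] (∀ k₀ → ∃[ k ] (k₀ ℕ.≤ k × φ (x ⇂ k) ℕ.≤ M))) where

  open Trees em X X-respects φ
  open Measures em X X-respects φ φ≤length

  module _ (T₀ : Tree) where

    -- Relative measures along y tending to 1, and infinitely often bounded away from 1.
    Thick : Cantor → Set
    Thick y = ∀ M → ∃[ n₀ ] (∀ n → n₀ ℕ.≤ n → deficit (run T₀ y n) ≤ 2⁻ M)

    Thin : Cantor → Set
    Thin y = ∃[ M ] (∀ n₀ → ∃[ n ] ∃[ s ] (n₀ ℕ.≤ n × length s ℕ.≤ M × (∀ w → N s w → Dis (run T₀ y n) w)))

    Acc-drop : ∀ w n → Acc (run T₀ w n) (drop n w) → Acc T₀ w
    Acc-drop w n (k , z , eq , z∈X) = k ℕ.+ n , z , trans (run-+ T₀ w n k) eq , z∈X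

    Dis-drop : ∀ w n → Dis (run T₀ w n) (drop n w) → Dis T₀ w
    Dis-drop w n (k , z , eq , z∉X) = k ℕ.+ n , z , trans (run-+ T₀ w n k) eq , z∉X

    run-N : ∀ y n w → N (y ↾ n) w → run T₀ y n ≡ run T₀ w n
    run-N y n w w∈N = run-Agree T₀ n (N⇒Agree n w∈N)

    -- A cover of S ∩ N_t that is too cheap, joined to the cover of the rejected part, would cover
    -- N_t for less than its weight.
    Thick⇒Φ : ∀ {S y} → (∀ w → Acc T₀ w → S w) → Thick y → Φ S y
    Thick⇒Φ {S} {y} Acc⊆S thick ε 0<ε = at-scale (2⁻-small (½-positive 0<ε))
      where
      Close : ℕ → Set
      Close n = ((1ℚ - ε) * weight (y ↾ n)) <μ[ S ∩ N (y ↾ n) ] × (μ[ S ∩ N (y ↾ n) ]< ((1ℚ + ε) * weight (y ↾ n)))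
      close : ∀ {M} → 2⁻ M < ½ * ε → ∀ n → deficit (run T₀ y n) ≤ 2⁻ M → Close n
      close {M} 2⁻M<½ε n deficit≤ = (r , lower-< , lower) , Cov⇒μ (Cov-mono (λ _ → proj₂) ≤-refl (Cov-N t)) upper-<
        where
        t = y ↾ n
        W = weight t
        0<W : 0ℚ < W
        0<W = weight-positive t
        r = (1ℚ - ½ * ε) * W
        0<Wε : 0ℚ < W * (½ * ε)
        0<Wε = *-positive 0<W (½-positive 0<ε)
        lower-< : (1ℚ - ε) * W < r
        lower-< = <-from 0<Wε (solve 2 (λ e w → (con 1ℚ :- e) :* w :+ w :* (con ½ :* e) := (con 1ℚ :- con ½ :* e) :* w :+ con 0ℚ) refl ε W)
        upper-< : W < (1ℚ + ε) * W
        upper-< = <-from (*-positive 0<W 0<ε) (solve 2 (λ e w → w :+ w :* e := (con 1ℚ :+ e) :* w :+ con 0ℚ) refl ε W)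
        Gap : Subset
        Gap w = N t w × Rej (run T₀ y n) (drop (length t) w)
        Cov-Gap : Cov Gap (W * deficit (run T₀ y n))
        Cov-Gap = Cov-lift t (λ _ p → p) (Cov-deficit (run T₀ y n))
        decide : ∀ w → N t w → (S ∩ N t) w ⊎ Gap w
        decide w w∈t with em {Acc T₀ w}
        ... | yes acc = inj₁ (Acc⊆S w acc , w∈t)
        ... | no rej  = inj₂ (w∈t , λ acc → rej (Acc-drop w n (subst₂ (λ T k → Acc T (drop k w))
                          (run-N y n w w∈t) (length-applyUpTo y n) acc)))
        lower : ¬ (μ[ S ∩ N t ]< r)
        lower μ<r = refute (μ⇒Cov μ<r)
          where
          refute : ∃[ r′ ] (r′ < r × Cov (S ∩ N t) r′) → ⊥
          refute (r′ , r′<r , cov) = <-irrefl refl (≤-<-trans (weight≤Cov-N em t (Cov-∪ decide cov Cov-Gap))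
            (<-from (+-mono-< r′<r (≤-<-trans (*-monoʳ-≤ W (<⇒≤ 0<W) deficit≤) (*-monoʳ-< W 0<W 2⁻M<½ε)))
              (solve 4 (λ r′ d e w → r′ :+ d :+ ((con 1ℚ :- con ½ :* e) :* w :+ w :* (con ½ :* e)) := w :+ (r′ :+ d)) refl
                r′ (W * deficit (run T₀ y n)) ε W)))
      at-scale : ∃[ M ] 2⁻ M < ½ * ε → ∃[ n₀ ] (∀ n → n₀ ℕ.≤ n → Close n)
      at-scale (M , 2⁻M<½ε) = proj₁ (thick M) , λ n n₀≤n → close {M} 2⁻M<½ε n (proj₂ (thick M) n n₀≤n)

    -- Missing a cylinder of relative measure at least 2⁻ M keeps the density at most 1 - 2⁻ M,
    -- infinitely often; so ε = 2⁻ M refutes convergence to 1.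
    Thin⇒¬Φ : ∀ {S y} → (∀ w → S w → ¬ Dis T₀ w) → Thin y → ¬ Φ S y
    Thin⇒¬Φ {S} {y} S⊆∁Dis (M , thin) y∈Φ = at (y∈Φ (2⁻ M) (2⁻-positive M))
      where
      refute : ∀ n s → length s ℕ.≤ M → (∀ w → N s w → Dis (run T₀ y n) w) →
        ¬ (((1ℚ - 2⁻ M) * weight (y ↾ n)) <μ[ S ∩ N (y ↾ n) ])
      refute n s s≤M dis (r , <r , ¬μ<r) = ¬μ<r (Cov⇒μ (Cov-lift t avoids (Cov-∁N s)) (≤-<-trans W*≤ <r))
        where
        t = y ↾ n
        W = weight t
        W*≤ : W * (1ℚ - weight s) ≤ (1ℚ - 2⁻ M) * W
        W*≤ = ≤-from (*-monoʳ-≤ W (<⇒≤ (weight-positive t))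
            (≤-trans (2⁻-antitone {length s} {M} s≤M) (≤-reflexive (sym (weight-2⁻ s)))))
          (solve 3 (λ w s p → w :* (con 1ℚ :- s) :+ w :* s := (con 1ℚ :- p) :* w :+ w :* p) refl W (weight s) (2⁻ M))
        avoids : ∀ w → (S ∩ N t) w → N t w × ¬ N s (drop (length t) w)
        avoids w (w∈S , w∈t) = w∈t , λ w∈s → S⊆∁Dis w w∈S (Dis-drop w n
          (subst₂ (λ T k → Dis T (drop k w)) (run-N y n w w∈t) (length-applyUpTo y n) (dis _ w∈s)))
      at : ∃[ n₀ ] (∀ n → n₀ ℕ.≤ n →
        ((1ℚ - 2⁻ M) * weight (y ↾ n)) <μ[ S ∩ N (y ↾ n) ] × (μ[ S ∩ N (y ↾ n) ]< ((1ℚ + 2⁻ M) * weight (y ↾ n)))) → ⊥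
      at (n₀ , near) with thin n₀
      ... | n , s , n₀≤n , s≤M , dis = refute n s s≤M dis (proj₁ (near n n₀≤n))

  module Reductions (T₀ : Tree) (ℓ₀ : ℕ)
    (start : ∀ y → ¬ ReachesLeaf T₀ y → ∃[ m ] run T₀ y ℓ₀ ≡ root [] m)
    (Comp-start : ∀ x → Comp x T₀) where

    open From T₀ ℓ₀ start Comp-start

    Thick-g : ∀ y → X (g y) → Thick T₀ y
    Thick-g y gy∈X M = decide (em {ReachesLeaf T₀ y})
      where
      decide : Dec (ReachesLeaf T₀ y) → ∃[ n₀ ] (∀ n → n₀ ℕ.≤ n → deficit (run T₀ y n) ≤ 2⁻ M)
      decide (yes (n₀ , z , eq)) = n₀ , λ n n₀≤n →
        subst (λ T → deficit T ≤ 2⁻ M) (sym (leaf-persists T₀ y n₀≤n eq))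
          (subst (_≤ 2⁻ M) (sym (loss-∈ (subst X (g-leaf y n₀ eq) gy∈X))) (<⇒≤ (2⁻-positive M)))
      decide (no live) = time k₀ , λ n t≤n → bound n (Stage-after live k₀ n t≤n)
        where
        large : ∃[ k₀ ] (∀ k → k₀ ℕ.≤ k → M ℕ.≤ φ (limit y ⇂ k))
        large = φ-unbounded (limit y) (subst X (g-limit live) gy∈X) M
        k₀ = proj₁ large
        bound : ∀ n → ∃[ u ] (k₀ ℕ.≤ length u × Stage u (run T₀ y n)) → deficit (run T₀ y n) ≤ 2⁻ M
        bound n (u , k₀≤ , stage) = ≤-trans (deficit-Stage stage) (2⁻-antitone {M} {φ u}
          (subst (λ v → M ℕ.≤ φ v) (limit-≻ live n (Stage-Ext stage)) (proj₂ large (length u) k₀≤)))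

    run-delay : ∀ j y T w → N (replicate j true) w → run (delay j y T) w j ≡ T
    run-delay zero    y T w _   = refl
    run-delay (suc j) y T w w∈ with N-∷⁻ {true} {replicate j true} {w} w∈
    ... | w0 , w∈′ = trans (cong (run (delay (suc j) y T) w) (ℕ.+-comm 1 j))
      (trans (run-+ (delay (suc j) y T) w 1 j)
        (trans (cong (λ b → run (step (delay (suc j) y T) b) (tail w) j) w0) (run-delay j y T (tail w) w∈′)))

    -- The first `true` leads from the root into `miss`; the next φ u pass its delay and arrive at
    -- the point outside X.
    Dis-root : ∀ u m w → N (replicate (suc (φ u)) true) w → Dis (root u m) w
    Dis-root u m w w∈ with N-∷⁻ {true} {replicate (φ u) true} {w} w∈
    ... | w0 , w∈′ = φ u ℕ.+ 1 , outside m ,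
      trans (run-+ (root u m) w 1 (φ u))
        (trans (cong (λ b → run (step (root u m) b) (tail w) (φ u)) w0)
          (run-delay (φ u) (inside m) (leaf (outside m)) (tail w) w∈′)) ,
      proj₂ (proj₂ (proj₂ m))

    Thin-g : ∀ y → ¬ X (g y) → Thin T₀ y
    Thin-g y gy∉X = decide (em {ReachesLeaf T₀ y})
      where
      decide : Dec (ReachesLeaf T₀ y) → Thin T₀ y
      -- Below a leaf outside X the whole cylinder is rejected, so the empty word is a witness.
      decide (yes (n , z , eq)) = 0 , λ n₀ → n₀ ℕ.⊔ n , [] , ℕ.m≤m⊔n n₀ n , ℕ.z≤n , λ w _ →
        0 , z , leaf-persists T₀ y (ℕ.m≤n⊔m n₀ n) eq , subst (λ x → ¬ X x) (g-leaf y n eq) gy∉X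
      decide (no live) = suc (proj₁ small) , λ n₀ → at (proj₂ small n₀)
        where
        small : ∃[ M ] (∀ k₀ → ∃[ k ] (k₀ ℕ.≤ k × φ (limit y ⇂ k) ℕ.≤ M))
        small = φ-bounded (limit y) (subst (λ x → ¬ X x) (g-limit live) gy∉X)
        at : ∀ {n₀} → ∃[ k ] (n₀ ℕ.≤ k × φ (limit y ⇂ k) ℕ.≤ proj₁ small) →
          ∃[ n ] ∃[ s ] (n₀ ℕ.≤ n × length s ℕ.≤ suc (proj₁ small) × (∀ w → N s w → Dis (run T₀ y n) w))
        at (k , n₀≤k , φ≤M) with at-root live k
        ... | m , eq = time k , replicate (suc (φ (limit y ⇂ k))) true , ℕ.≤-trans n₀≤k (n≤time k) ,
          ℕ.≤-trans (ℕ.≤-reflexive (length-replicate (suc (φ (limit y ⇂ k))))) (ℕ.s≤s φ≤M) ,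
          λ w w∈ → subst (λ T → Dis T w) (sym eq) (Dis-root (limit y ⇂ k) m w w∈)

    module _ {S : Subset} (Acc⊆S : ∀ w → Acc T₀ w → S w) (S⊆∁Dis : ∀ w → S w → ¬ Dis T₀ w) where

      -- As `g` does not mention `S`, all sets between `Acc T₀` and the complement of `Dis T₀` have
      -- the same density points.
      Φ-g : Φ S ≐ (λ y → X (g y))
      Φ-g = to , λ {y} gy∈X → Thick⇒Φ T₀ Acc⊆S (Thick-g y gy∈X)
        where
        to : ∀ {y} → Φ S y → X (g y)
        to {y} y∈Φ with em {X (g y)}
        ... | yes gy∈X = gy∈X
        ... | no gy∉X  = contradiction y∈Φ (Thin⇒¬Φ T₀ S⊆∁Dis (Thin-g y gy∉X))

      X≡WΦ : X ≡W Φ S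
      X≡WΦ = (h , h-continuous , (λ {x} x∈X → proj₂ Φ-g (proj₂ (g∘h x) x∈X)) , λ {x} hx∈Φ → proj₁ (g∘h x) (proj₁ Φ-g hx∈Φ)) ,
             (g , g-continuous , Φ-g)

-- The theorem

left : Clopen → Clopen
left (const b)   = const b
left (split D _) = D

right : Clopen → Clopen
right (const b)   = const b
right (split _ E) = E

pick⁺ : ∀ D {x} → ⟦ D ⟧ x → ⟦ (if x 0 then right D else left D) ⟧ (tail x)
pick⁺ (const b)   {x} p with x 0
... | false = p
... | true  = p
pick⁺ (split D E) {x} p with x 0
... | false = p
... | true  = p

pick⁻ : ∀ D {x} → ⟦ (if x 0 then right D else left D) ⟧ (tail x) → ⟦ D ⟧ x
pick⁻ (const b)   {x} p with x 0
... | false = p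
... | true  = p
pick⁻ (split D E) {x} p with x 0
... | false = p
... | true  = p

≐⇒≤W : ∀ {X Y} → X ≐ Y → X ≤W Y
≐⇒≤W X≐Y = (λ x → x) , (λ x n → n , λ y same → same) , X≐Y

-- Grafting the coding tree into a clopen set

module Grafting (em : ExcludedMiddle 0ℓ) (X : Subset)
  (X-respects : ∀ {x y} → (∀ i → x i ≡ y i) → X x → X y) (φ : List Bool → ℕ)
  (φ≤length : ∀ u → φ u ℕ.≤ length u) (x⁺ : ∃[ x ] X x) (x⁻ : ∃[ x ] ¬ X x) where

  open Trees em X X-respects φ
  open Measures em X X-respects φ φ≤length

  embed : Clopen → Tree
  embed (const true)  = leaf (proj₁ x⁺)
  embed (const false) = leaf (proj₁ x⁻)
  embed (split D E)   = node (always false) (embed D) (embed E)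

  -- The coding takes place in the cylinder of k zeros, where `D` is discarded at a cost of at most
  -- 2⁻ k. The labels on the way send every x there.
  graft : ℕ → Clopen → Tree
  graft zero    D = root [] ((proj₁ x⁺ , refl , proj₂ x⁺) , (proj₁ x⁻ , refl , proj₂ x⁻))
  graft (suc k) D = node (always false) (graft k (left D)) (embed (right D))

  Doomed-embed : ∀ D → Doomed (embed D)
  Doomed-embed (const true)  = Doomed-leaf _
  Doomed-embed (const false) = Doomed-leaf _
  Doomed-embed (split D E)   = Doomed-node (always false) (Doomed-embed D) (Doomed-embed E)

  graft-start : ∀ k D y → ¬ ReachesLeaf (graft k D) y → ∃[ m ] run (graft k D) y k ≡ root [] m
  graft-start zero    D y live = _ , refl
  graft-start (suc k) D y live = arrive (y 0) refl
    where
    T = graft (suc k) D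
    arrive : ∀ b → y 0 ≡ b → ∃[ m ] run T y (suc k) ≡ root [] m
    arrive true  y0 = contradiction (ReachesLeaf-step T y (subst (λ b → ReachesLeaf (step T b) (tail y)) (sym y0) (Doomed-embed (right D) (tail y)))) live
    arrive false y0 = below (graft-start k (left D) (tail y) (λ reaches →
        live (ReachesLeaf-step T y (subst (λ b → ReachesLeaf (step T b) (tail y)) (sym y0) reaches))))
      where
      below : ∃[ m ] run (graft k (left D)) (tail y) k ≡ root [] m → ∃[ m ] run T y (suc k) ≡ root [] m
      below (m , eq) = m , trans (cong (run T y) (ℕ.+-comm 1 k)) (trans (run-+ T y 1 k)
        (trans (cong (λ b → run (step T b) (tail y) k) y0) eq))

  Comp-graft : ∀ k D x → Comp x (graft k D)
  Comp-graft zero    D x = refl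
  Comp-graft (suc k) D x = Comp-graft k (left D) x

  Acc-embed⁺ : ∀ D x → ⟦ D ⟧ x → Acc (embed D) x
  Acc-embed⁺ (const true) x p = 0 , proj₁ x⁺ , refl , proj₂ x⁺
  Acc-embed⁺ (split D E)  x p = Acc-step⁺ (embed (split D E)) x (go p)
    where
    go : ⟦ split D E ⟧ x → Acc (step (embed (split D E)) (x 0)) (tail x)
    go p with x 0
    ... | false = Acc-embed⁺ D (tail x) p
    ... | true  = Acc-embed⁺ E (tail x) p

  Acc-embed⁻ : ∀ D x → Acc (embed D) x → ⟦ D ⟧ x
  Acc-embed⁻ (const true)  x _   = refl
  Acc-embed⁻ (const false) x acc = contradiction (0 , proj₁ x⁻ , refl , proj₂ x⁻) (Acc-Dis-disjoint (leaf (proj₁ x⁻)) x acc)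
  Acc-embed⁻ (split D E)   x acc = go (Acc-step⁻ (embed (split D E)) x acc)
    where
    go : Acc (step (embed (split D E)) (x 0)) (tail x) → ⟦ split D E ⟧ x
    go acc with x 0
    ... | false = Acc-embed⁻ D (tail x) acc
    ... | true  = Acc-embed⁻ E (tail x) acc

  Acc-graft⁺ : ∀ k D x → ¬ N (replicate k false) x → ⟦ D ⟧ x → Acc (graft k D) x
  Acc-graft⁺ zero    D x x∉ p = contradiction refl x∉
  Acc-graft⁺ (suc k) D x x∉ p = Acc-step⁺ (graft (suc k) D) x (go (x 0) refl)
    where
    go : ∀ b → x 0 ≡ b → Acc (step (graft (suc k) D) (x 0)) (tail x)
    go false x0 = subst (λ b → Acc (step (graft (suc k) D) b) (tail x)) (sym x0)
      (Acc-graft⁺ k (left D) (tail x) (λ q → x∉ (N-∷⁺ {x = x} x0 q))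
        (subst (λ b → ⟦ (if b then right D else left D) ⟧ (tail x)) x0 (pick⁺ D p)))
    go true  x0 = subst (λ b → Acc (step (graft (suc k) D) b) (tail x)) (sym x0)
      (Acc-embed⁺ (right D) (tail x)
        (subst (λ b → ⟦ (if b then right D else left D) ⟧ (tail x)) x0 (pick⁺ D p)))

  Acc-graft⁻ : ∀ k D x → ¬ N (replicate k false) x → Acc (graft k D) x → ⟦ D ⟧ x
  Acc-graft⁻ zero    D x x∉ acc = contradiction refl x∉
  Acc-graft⁻ (suc k) D x x∉ acc = pick⁻ D (go (x 0) refl (Acc-step⁻ (graft (suc k) D) x acc))
    where
    go : ∀ b → x 0 ≡ b → Acc (step (graft (suc k) D) (x 0)) (tail x) → ⟦ (if x 0 then right D else left D) ⟧ (tail x)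
    go false x0 acc = subst (λ b → ⟦ (if b then right D else left D) ⟧ (tail x)) (sym x0)
      (Acc-graft⁻ k (left D) (tail x) (λ q → x∉ (N-∷⁺ {x = x} x0 q))
        (subst (λ b → Acc (step (graft (suc k) D) b) (tail x)) x0 acc))
    go true  x0 acc = subst (λ b → ⟦ (if b then right D else left D) ⟧ (tail x)) (sym x0)
      (Acc-embed⁻ (right D) (tail x) (subst (λ b → Acc (step (graft (suc k) D) b) (tail x)) x0 acc))

  Acc-open : ∀ T → IsOpen (Acc T)
  Acc-open T y (n , z , eq , z∈X) = n , λ {w} w∈ → n , z , trans (sym (run-Agree T n (N⇒Agree n w∈))) eq , z∈X

  ∁Dis-closed : ∀ T → IsClosed (∁ (Dis T))
  ∁Dis-closed T y ¬¬dis with em {Dis T y}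
  ... | no ¬dis = contradiction ¬dis ¬¬dis
  ... | yes (n , z , eq , z∉X) = n , λ {w} w∈ ¬dis →
          ¬dis (n , z , trans (sym (run-Agree T n (N⇒Agree n w∈))) eq , z∉X)

  graft-close : ∀ {A D ε} k → μ[ A △ ⟦ D ⟧ ]< (½ * ε) → 2⁻ k < ½ * ε → μ[ A △ Acc (graft k D) ]< ε
  graft-close {A} {D} {ε} k near 2⁻k< = from-Cov (μ⇒Cov near)
    where
    inclusion : ∀ x → (A △ Acc (graft k D)) x → (A △ ⟦ D ⟧) x ⊎ N (replicate k false) x
    inclusion x diff with em {N (replicate k false) x}
    ... | yes x∈ = inj₂ x∈
    inclusion x (inj₁ (x∈A , x∉B)) | no x∉ = inj₁ (inj₁ (x∈A , λ p → x∉B (Acc-graft⁺ k D x x∉ p)))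
    inclusion x (inj₂ (x∈B , x∉A)) | no x∉ = inj₁ (inj₂ (Acc-graft⁻ k D x x∉ x∈B , x∉A))
    from-Cov : ∃[ r ] (r < ½ * ε × Cov (A △ ⟦ D ⟧) r) → μ[ A △ Acc (graft k D) ]< ε
    from-Cov (r , r< , cov) = Cov⇒μ (Cov-∪ inclusion cov (Cov-N (replicate k false)))
      (subst (λ w → r + w < ε) (sym (trans (weight-2⁻ (replicate k false)) (cong 2⁻_ (length-replicate k))))
        (<-from (+-mono-< r< 2⁻k<) (solve 3 (λ r p e → r :+ p :+ (con ½ :* e :+ con ½ :* e) := e :+ (r :+ p)) refl r (2⁻ k) ε)))

theorem1p8 : ExcludedMiddle 0ℓ →
    (d : Pred Subset 0ℓ) → IsWadgeDegree d →
    d ⊆ IsΠ⁰₃ → ¬ (d ≐ (_≐ ∅)) → ¬ (d ≐ (_≐ U)) →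
    Dense (𝒲 d) ×
    (∀ (A : Subset) → Measurable A → ∀ (ε : ℚ) → 0ℚ < ε →
    ∃ λ (B : Subset) → Measurable B × (μ[ A △ B ]< ε) × Φ B ∈ d ×
    (∃ λ (V : Subset) → IsOpen V × Φ B ≐ Φ V) ×
    (∃ λ (C : Subset) → IsClosed C × Φ B ≐ Φ C))
theorem1p8 em d (X , d⊆ , ⊆d) d⊆Π⁰₃ d≢∅ d≢U = dense , approximate
  where
  X∈Π⁰₃ : IsΠ⁰₃ X
  X∈Π⁰₃ = d⊆Π⁰₃ (⊆d (X≤WX , X≤WX))
    where
    X≤WX : X ≤W X
    X≤WX = ≐⇒≤W {X} {X} ((λ p → p) , λ p → p)

  x⁺ : ∃[ x ] X x
  x⁺ with em {∃[ x ] X x}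
  ... | yes p = p
  ... | no ¬p = ⊥-elim (d≢∅ ((λ Y∈d → empty (d⊆ Y∈d)) , λ Y-empty → ⊆d (same Y-empty)))
    where
    empty : ∀ {Y} → X ≡W Y → Y ≐ ∅
    empty (_ , f , _ , Y⊆ , _) = (λ y∈ → ¬p (_ , Y⊆ y∈)) , λ ()
    same : ∀ {Y} → Y ≐ ∅ → X ≡W Y
    same {Y} (Y⊆ , _) = ≐⇒≤W {X} {Y} ((λ x∈ → contradiction (_ , x∈) ¬p) , λ y∈ → ⊥-elim (Y⊆ y∈)) ,
                        ≐⇒≤W {Y} {X} ((λ y∈ → ⊥-elim (Y⊆ y∈)) , λ x∈ → contradiction (_ , x∈) ¬p)

  x⁻ : ∃[ x ] ¬ X x
  x⁻ with em {∃[ x ] ¬ X x}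
  ... | yes p = p
  ... | no ¬p = ⊥-elim (d≢U ((λ Y∈d → full (d⊆ Y∈d)) , λ Y-full → ⊆d (same Y-full)))
    where
    all : ∀ x → X x
    all x with em {X x}
    ... | yes x∈ = x∈
    ... | no x∉  = contradiction (x , x∉) ¬p
    full : ∀ {Y} → X ≡W Y → Y ≐ U
    full (_ , f , _ , _ , ⊆Y) = (λ _ → tt) , λ _ → ⊆Y (all _)
    same : ∀ {Y} → Y ≐ U → X ≡W Y
    same {Y} (_ , U⊆) = ≐⇒≤W {X} {Y} ((λ _ → U⊆ tt) , λ _ → all _) , ≐⇒≤W {Y} {X} ((λ _ → all _) , λ _ → U⊆ tt)

  Goal : Subset → ℚ → Set₁
  Goal A ε = ∃ λ (B : Subset) → Measurable B × (μ[ A △ B ]< ε) × Φ B ∈ d ×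
    (∃ λ (V : Subset) → IsOpen V × Φ B ≐ Φ V) ×
    (∃ λ (C : Subset) → IsClosed C × Φ B ≐ Φ C)

  approximate : ∀ A → Measurable A → ∀ ε → 0ℚ < ε → Goal A ε
  -- Half of `ε` is spent on the clopen approximation, half on the cylinder that receives K.
  approximate A measurable ε 0<ε = build (Π⁰₃-rank em X∈Π⁰₃)
    (clopen-approximation em measurable (½-positive 0<ε)) (2⁻-small (½-positive 0<ε))
    where
    build : (∃ λ (φ : List Bool → ℕ) → (∀ u → φ u ℕ.≤ length u) ×
        (∀ x → X x → ∀ M → ∃[ k₀ ] (∀ k → k₀ ℕ.≤ k → M ℕ.≤ φ (x ⇂ k))) ×
        (∀ x → ¬ X x → ∃[ M ] (∀ k₀ → ∃[ k ] (k₀ ℕ.≤ k × φ (x ⇂ k) ℕ.≤ M)))) →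
      ∃[ D ] μ[ A △ ⟦ D ⟧ ]< (½ * ε) → ∃[ k ] 2⁻ k < ½ * ε → Goal A ε
    build (φ , φ≤length , φ-unbounded , φ-bounded) (D , near) (k , 2⁻k<) =
      Acc T₀ , Acc-measurable T₀ , graft-close k near 2⁻k< , ⊆d (X≡WΦ Acc⊆Acc Acc⊆∁Dis) ,
      (Acc T₀ , Acc-open T₀ , (λ p → p) , (λ p → p)) ,
      (∁ (Dis T₀) , ∁Dis-closed T₀ ,
        (λ p → proj₂ (Φ-g Acc⊆∁Dis ∁Dis⊆) (proj₁ (Φ-g Acc⊆Acc Acc⊆∁Dis) p)) ,
        (λ p → proj₂ (Φ-g Acc⊆Acc Acc⊆∁Dis) (proj₁ (Φ-g Acc⊆∁Dis ∁Dis⊆) p)))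
      where
      X-respects : ∀ {x y} → (∀ i → x i ≡ y i) → X x → X y
      X-respects = Π⁰₃-respects em X∈Π⁰₃
      open Trees em X X-respects φ
      open Measures em X X-respects φ φ≤length
      open Grafting em X X-respects φ φ≤length x⁺ x⁻
      open Densities em X X-respects φ φ≤length φ-unbounded φ-bounded
      T₀ : Tree
      T₀ = graft k D
      open Reductions T₀ k (graft-start k D) (Comp-graft k D)
      Acc⊆Acc : ∀ w → Acc T₀ w → Acc T₀ w
      Acc⊆Acc _ acc = acc
      Acc⊆∁Dis : ∀ w → Acc T₀ w → ¬ Dis T₀ w
      Acc⊆∁Dis w = Acc-Dis-disjoint T₀ w
      ∁Dis⊆ : ∀ w → ¬ Dis T₀ w → ¬ Dis T₀ w
      ∁Dis⊆ _ ¬dis = ¬dis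

  dense : Dense (𝒲 d)
  dense (A , measurable) ε 0<ε = represent (approximate A measurable ε 0<ε)
    where
    represent : Goal A ε → ∃ λ b → b ∈ 𝒲 d × δ[ (A , measurable) , b ]< ε
    represent (B , B-measurable , near , ΦB∈d , _) = (B , B-measurable) ,
      ((B , B-measurable) , (λ ε′ 0<ε′ → Cov⇒μ (Cov-∅ empty) 0<ε′) , ΦB∈d) , near
      where
      empty : ∀ x → ¬ (B △ B) x
      empty x (inj₁ (x∈ , x∉)) = x∉ x∈
      empty x (inj₂ (x∈ , x∉)) = x∉ x∈
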